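{- Let $Q_n(x,y,z,t)$ be the polynomials defined by $Q_1=1$ and $Q_{n+1}=\bigl[x+nz+(y+t)(n+y\,\partial_y)\bigr]Q_n$ for $n\ge1$, and set $R_n(x,y,z,t)=Q_n(x,y+1,z,t-1)$. Then for every $n\ge1$, \[ R_n(x,y,z,t)=\sum_{T\in\mathcal{C}_{n+1}} (y+1)^{\operatorname{impe}(T)-\operatorname{impp}(T)}\,(y+t)^{\operatorname{impp}(T)}\,x^{\deg_T(1)-1}\,z^{\operatorname{lead}(T)-\deg_T(1)-1}. \]
   Context: $\mathcal{C}_m$ is the set of trees on vertex set $[m]=\{1,\dots,m\}$ (vertices are their own labels, $\lambda_T(i)=i$), rooted at $1$. Edges are oriented from parent to child: $(i,j)$ means $i$ is the parent of $j$. $\deg_T(1)$ is the number of children of the root. For a vertex $v$, $\beta_T(v)$ is the smallest label among descendants of $v$ ($v$ included). An edge $(i,j)$ is improper if $\lambda_T(i)>\beta_T(j)$; $\operatorname{impe}(T)$ is the number of improper edges. A vertex is an improper parent if it has at least one improper child; $\operatorname{impp}(T)$ is their number. For a vertex $i$ with root-to-$i$ path $L(i)=(1=a_0,\dots,a_k=i)$, its greater ancestors path is the longest terminal segment $(a_p,\dots,a_k)$ of $L(i)$ all of whose vertices $j$ satisfy $\lambda_T(j)\ge\lambda_T(i)$; $i$ is leading if $\beta_T(a_p)=\lambda_T(i)$; $\operatorname{lead}(T)$ is the number of leading vertices. -}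

module Defs where

open import Data.Nat as ℕ using (ℕ; zero; suc; _∸_; _≤ᵇ_; _<ᵇ_)
open import Data.Integer as ℤ using (ℤ; +_; -_)
open import Data.Fin using (Fin; zero; suc; toℕ)
open import Data.Fin.Properties using (any?; all?)
import Data.Fin.Properties as FinP
open import Data.List using (List; []; _∷_; _++_; map; concatMap; foldr; length; filter; allFin)
open import Data.Product using (_×_; _,_; ∃)
open import Data.Bool using (Bool; true; false; if_then_else_; _∧_)
import Data.Bool as Bool
open import Relation.Nullary using (Dec; yes; no; does; ¬_)
open import Relation.Binary.PropositionalEquality using (_≡_)

-- Formal polynomials in four variables x, y, z, t with ℤ coefficients.
-- A polynomial is a finite list of terms (coefficient, exponents);
-- two polynomials are equal iff all their coefficients agree.

Mono : Set
Mono = ℕ × ℕ × ℕ × ℕ   -- exponents of x, y, z, t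

Poly : Set
Poly = List (ℤ × Mono)

_≟M_ : (a b : Mono) → Dec (a ≡ b)
(a , b , c , d) ≟M (a' , b' , c' , d') with a ℕ.≟ a' | b ℕ.≟ b' | c ℕ.≟ c' | d ℕ.≟ d'
... | yes _≡_.refl | yes _≡_.refl | yes _≡_.refl | yes _≡_.refl = yes _≡_.refl
... | no ne | _ | _ | _ = no λ { _≡_.refl → ne _≡_.refl }
... | yes _ | no ne | _ | _ = no λ { _≡_.refl → ne _≡_.refl }
... | yes _ | yes _ | no ne | _ = no λ { _≡_.refl → ne _≡_.refl }
... | yes _ | yes _ | yes _ | no ne = no λ { _≡_.refl → ne _≡_.refl }

coeff : Poly → Mono → ℤ
coeff [] e = + 0
coeff ((c , m) ∷ p) e = if does (m ≟M e) then c ℤ.+ coeff p e else coeff p e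

infix 4 _≈P_
_≈P_ : Poly → Poly → Set
p ≈P q = ∀ e → coeff p e ≡ coeff q e

cst : ℤ → Poly
cst c = (c , 0 , 0 , 0 , 0) ∷ []

X Y Z T : Poly
X = (+ 1 , 1 , 0 , 0 , 0) ∷ []
Y = (+ 1 , 0 , 1 , 0 , 0) ∷ []
Z = (+ 1 , 0 , 0 , 1 , 0) ∷ []
T = (+ 1 , 0 , 0 , 0 , 1) ∷ []

infixl 6 _+P_
infixl 7 _*P_

_+P_ : Poly → Poly → Poly
p +P q = p ++ q

mulM : (ℤ × Mono) → (ℤ × Mono) → (ℤ × Mono)
mulM (c , a , b , d , e) (c' , a' , b' , d' , e') =
  (c ℤ.* c' , a ℕ.+ a' , b ℕ.+ b' , d ℕ.+ d' , e ℕ.+ e')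

_*P_ : Poly → Poly → Poly
p *P q = concatMap (λ s → map (mulM s) q) p

powP : Poly → ℕ → Poly
powP p zero = cst (+ 1)
powP p (suc k) = p *P powP p k

dY : Poly → Poly
dY = map (λ { (c , a , b , d , e) → (c ℤ.* + b , a , b ∸ 1 , d , e) })

op : ℕ → Poly → Poly
op n p = (X +P cst (+ n) *P Z) *P p +P (Y +P T) *P (cst (+ n) *P p +P Y *P dY p)

-- Q n = Q_n for n ≥ 1 (Q 0 is an unused junk value)
Q : ℕ → Poly
Q zero = cst (+ 1)
Q (suc zero) = cst (+ 1)
Q (suc (suc k)) = op (suc k) (Q (suc k))

shift : Poly → Poly
shift = concatMap (λ { (c , a , b , d , e) →
  cst c *P powP X a *P powP (Y +P cst (+ 1)) b *P powP Z d *P powP (T +P cst (- + 1)) e })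

R : ℕ → Poly
R n = shift (Q n)

sumP : List Poly → Poly
sumP = foldr _+P_ []

-- Rooted labelled trees on [m], m = suc n, rooted at 1.
-- Vertex v : Fin (suc n) has label toℕ v + 1 (so zero is the root 1).
-- A tree is given by its parent map on the non-root vertices:
-- vertex (suc i) has parent (p i); it is a tree iff every vertex
-- reaches the root by following parents.

Parents : ℕ → Set
Parents n = Fin n → Fin (suc n)

lbl : ∀ {n} → Fin n → ℕ
lbl v = suc (toℕ v)

iter : ∀ {A : Set} → (A → A) → ℕ → A → A
iter f zero x = x
iter f (suc k) x = f (iter f k x)

module _ {n : ℕ} (p : Parents n) where

  par : Fin (suc n) → Fin (suc n)
  par zero = zero
  par (suc i) = p i

  IsTree : Set
  IsTree = ∀ v → iter par n v ≡ zero

  isTree? : Dec IsTree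
  isTree? = all? (λ v → iter par n v FinP.≟ zero)

  Desc : Fin (suc n) → Fin (suc n) → Set
  Desc v w = ∃ λ (j : Fin (suc n)) → iter par (toℕ j) w ≡ v

  desc? : ∀ v w → Dec (Desc v w)
  desc? v w = any? (λ j → iter par (toℕ j) w FinP.≟ v)

  β : Fin (suc n) → ℕ
  β v = foldr (λ w acc → if does (desc? v w) then ℕ._⊓_ (lbl w) acc else acc) (lbl v) (allFin (suc n))

  count : (Fin (suc n) → Bool) → ℕ
  count P = length (filter (λ v → P v Bool.≟ true) (allFin (suc n)))

  -- edge (par j, j) for non-root j is improper iff λ(par j) > β(j)
  improperChild : Fin (suc n) → Bool
  improperChild zero = false
  improperChild (suc i) = β (suc i) <ᵇ lbl (p i)

  impe : ℕ
  impe = count improperChild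

  -- v is an improper parent iff some child j of v is improper
  -- (the root zero is never a child: improperChild zero = false)
  impp : ℕ
  impp = count (λ v → does (any? (λ j → (improperChild j ∧ does (par j FinP.≟ v)) Bool.≟ true)))

  deg1 : ℕ
  deg1 = count (λ { zero → false ; (suc i) → does (p i FinP.≟ zero) })

  -- top f i v: climb from v towards the root while the parent's label is ≥ λ(i);
  -- top n i i is the first vertex a_p of the greater ancestors path of i
  top : ℕ → Fin (suc n) → Fin (suc n) → Fin (suc n)
  top zero i v = v
  top (suc f) i zero = zero
  top (suc f) i (suc w) = if lbl i ≤ᵇ lbl (p w) then top f i (p w) else suc w

  leading : Fin (suc n) → Bool
  leading i = does (β (top n i i) ℕ.≟ lbl i)

  lead : ℕ
  lead = count leading

allFuns : (k m : ℕ) → List (Fin k → Fin m)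
allFuns zero m = (λ ()) ∷ []
allFuns (suc k) m = concatMap (λ f → map (λ a → cons a f) (allFin m)) (allFuns k m)
  where
  cons : Fin m → (Fin k → Fin m) → Fin (suc k) → Fin m
  cons a f zero = a
  cons a f (suc i) = f i

trees : (n : ℕ) → List (Parents n)
trees n = filter isTree? (allFuns n (suc n))

weight : ∀ {n} → Parents n → Poly
weight p = powP (Y +P cst (+ 1)) (impe p ∸ impp p) *P powP (Y +P T) (impp p)
         *P powP X (deg1 p ∸ 1) *P powP Z (lead p ∸ deg1 p ∸ 1)

RHS : ℕ → Poly
RHS n = sumP (map weight (trees n))

{-# OPTIONS --safe #-}
module Submission where

-- Trees on [n+2] are obtained from trees on [n+1] by inserting the largest label N.
-- Either N becomes a leaf (weight x below the root, z below any of the n other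
-- vertices), or N is put on the edge above a non-root vertex i (weight y + t), possibly
-- taking over from i its improper children k with β(k) ≤ β(j), for some improper
-- child j of i.  The latter has weight y + 1 if j has the largest β among the improper
-- children of i (impp p choices, as i is then no longer an improper parent) and y + t
-- otherwise (impe p − impp p choices).  Conversely, if N has children, the child with
-- the largest β absorbs the others as improper children and replaces N.  With
-- u = y + t and a = impe p − impp p, b = impp p, before the substitution
-- y ↦ y + 1, t ↦ t − 1, this is exactly
--   u (n + y ∂/∂y) yᵃuᵇ = (n + a) yᵃuᵇ⁺¹ + b yᵃ⁺¹uᵇ.

open import Defs
open import Data.Nat using (ℕ; _≤_)
open import Algebra.Bundles using (CommutativeSemiring)
open import Data.Bool using (Bool; if_then_else_; true; false; _∧_; _∨_; not)
import Data.Bool as Bool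
import Data.Bool.Properties as BoolP
open import Data.Empty using (⊥-elim)
open import Data.Fin using (Fin; zero; suc; toℕ; fromℕ; fromℕ<; inject₁; punchIn)
open import Data.Fin.Properties using (any?; pigeonhole; fromℕ≢inject₁; inject₁-injective)
import Data.Fin.Properties as FinP
open import Data.Fin.Relation.Unary.Top using (view; ‵fromℕ; ‵inject₁; view-fromℕ; view-inject₁)
open import Data.Integer as ℤ using (ℤ; +_; -_)
import Data.Integer.Properties as ℤP
import Data.Integer.Tactic.RingSolver as ℤSolver
open import Data.List using (List; []; _∷_; _++_; map; concatMap; foldr; length; filter; allFin; tabulate)
open import Data.List.Membership.Propositional using (_∈_; find; lose)
open import Data.List.Membership.Propositional.Properties using (∈-allFin; ∈-map⁺; ∈-map⁻; ∈-++⁺ˡ; ∈-++⁺ʳ; ∈-++⁻; ∈-concatMap⁺; ∈-concatMap⁻; ∈-filter⁺; ∈-filter⁻; ∈-tabulate⁻)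
open import Data.List.Membership.Propositional.Properties.WithK using (unique∧set⇒bag)
open import Data.List.Properties using (length-tabulate)
open import Data.List.Relation.Binary.BagAndSetEquality using (∼bag⇒↭)
open import Data.List.Relation.Binary.Permutation.Propositional as Perm using (_↭_)
open import Data.List.Relation.Binary.Pointwise as Pointwise using (Pointwise; []; _∷_)
open import Data.List.Relation.Unary.All as All using ([]; _∷_)
import Data.List.Relation.Unary.All.Properties as AllP
open import Data.List.Relation.Unary.AllPairs using ([]; _∷_)
open import Data.List.Relation.Unary.Any using (here; there)
open import Data.List.Relation.Unary.Unique.Propositional using (Unique)
import Data.List.Relation.Unary.Unique.Propositional.Properties as UniqueP
open import Data.Maybe using (nothing)
open import Data.Nat as ℕ using (zero; suc; _<_; z≤n; s≤s; _<ᵇ_; _≤ᵇ_)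
open import Data.Nat.Induction using (<-rec)
import Data.Nat.Properties as ℕP
import Data.Nat.Tactic.RingSolver as ℕSolver
open import Data.Product using (_×_; _,_; ∃; proj₁; proj₂)
open import Data.Sum using (_⊎_; inj₁; inj₂)
open import Data.Unit using (⊤; tt)
open import Data.Vec as Vec using (Vec; []; _∷_; lookup)
import Data.Vec.Properties as VecP
open import Function using (_∘_; id)
open import Function.Bundles using (mk⇔)
open import Relation.Binary.PropositionalEquality
open import Relation.Nullary using (Dec; does; yes; no; ¬_)
open import Relation.Nullary.Decidable using (dec-true; dec-false; _×-dec_; ¬?)
open import Algebra.Properties.CommutativeMonoid.Sum ℕP.+-0-commutativeMonoid
  using (sum; sum-remove; sum-cong-≗; sum-init-last; sum-replicate-zero; ∑-comm; ∑-distrib-+)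

-- Any set of improper children of `i` could be handed over to N, but then the children of N would
-- not reveal which of them is `i`. An initial segment with respect to β settles this: what remains
-- below `i`, namely `i` itself, its proper children and the improper children beyond `j`, has
-- labels above β(j), so `i` is the child of N with the strictly largest β. This dominance makes
-- insertion reversible. It also forces each child taken over to have β below λ(i), so that its edge
-- is improper before and after, and no old vertex gains or loses the property of leading. In the
-- new tree N inherits β(i), and every old vertex other than `i` keeps its β. The bijection is
-- carried out on vectors of parents, because equal trees have to be propositionally equal there,
-- and pointwise equal functions need not be. The induction begins with the tree on two vertices:
-- for the one-vertex tree deg - 1 would be truncated. The difference impe - impp is handled as a
-- count, that of the improper children having an improper sibling with larger β.

private variable
  A B : Set

-- Polynomials as linear functionals

-- Polynomial identities are proved after pairing both sides with an arbitrary
-- linear functional, given by its values φ on monomials; this makes every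
-- operation of Defs compatible with equality for free.
L : (Mono → ℤ) → Poly → ℤ
L φ [] = + 0
L φ ((c , m) ∷ p) = c ℤ.* φ m ℤ.+ L φ p

infix 4 _≃_
-- A record instead of a bare function type: `L` computes, so unification could not recover `p` and
-- `q` from the unfolded equations.
record _≃_ (p q : Poly) : Set where
  constructor pairing
  field pair : ∀ φ → L φ p ≡ L φ q
open _≃_

-- Extracting the coefficient at `e` is itself a linear functional, the one given by the indicator
-- `δ` of `e`.
≃⇒≈P : ∀ {p q} → p ≃ q → p ≈P q
≃⇒≈P {p} {q} h e = trans (coeff-L p) (trans (pair h δ) (sym (coeff-L q)))
  where
  δ : Mono → ℤ
  δ m = if does (m ≟M e) then + 1 else + 0
  coeff-L : ∀ r → coeff r e ≡ L δ r
  coeff-L [] = refl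
  coeff-L ((c , m) ∷ r) with does (m ≟M e)
  ... | true  = cong₂ ℤ._+_ (sym (ℤP.*-identityʳ c)) (coeff-L r)
  ... | false = trans (coeff-L r) (sym (trans (cong (ℤ._+ L δ r) (ℤP.*-zeroʳ c)) (ℤP.+-identityˡ _)))

infixl 6 _⊕_
_⊕_ : Mono → Mono → Mono
(a , b , d , e) ⊕ (a' , b' , d' , e') = a ℕ.+ a' , b ℕ.+ b' , d ℕ.+ d' , e ℕ.+ e'

cong₄ : ∀ {a a' b b' d d' e e' : ℕ} → a ≡ a' → b ≡ b' → d ≡ d' → e ≡ e' →
        (a , b , d , e) ≡ (a' , b' , d' , e')
cong₄ refl refl refl refl = refl

⊕-comm : ∀ m m' → m ⊕ m' ≡ m' ⊕ m
⊕-comm (a , b , d , e) (a' , b' , d' , e') =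
  cong₄ (ℕP.+-comm a a') (ℕP.+-comm b b') (ℕP.+-comm d d') (ℕP.+-comm e e')

⊕-assoc : ∀ m m' m'' → (m ⊕ m') ⊕ m'' ≡ m ⊕ (m' ⊕ m'')
⊕-assoc (a , b , d , e) (a' , b' , d' , e') (a'' , b'' , d'' , e'') =
  cong₄ (ℕP.+-assoc a a' a'') (ℕP.+-assoc b b' b'') (ℕP.+-assoc d d' d'') (ℕP.+-assoc e e' e'')

L-cong : ∀ {φ ψ} → (∀ m → φ m ≡ ψ m) → ∀ p → L φ p ≡ L ψ p
L-cong h [] = refl
L-cong h ((c , m) ∷ p) = cong₂ ℤ._+_ (cong (c ℤ.*_) (h m)) (L-cong h p)

L-++ : ∀ φ p q → L φ (p ++ q) ≡ L φ p ℤ.+ L φ q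
L-++ φ [] q = sym (ℤP.+-identityˡ _)
L-++ φ ((c , m) ∷ p) q = trans (cong (ℤ._+_ (c ℤ.* φ m)) (L-++ φ p q)) (sym (ℤP.+-assoc (c ℤ.* φ m) _ _))

L-zero : ∀ p → L (λ _ → + 0) p ≡ + 0
L-zero [] = refl
L-zero ((c , m) ∷ p) = trans (cong₂ ℤ._+_ (ℤP.*-zeroʳ c) (L-zero p)) refl

L-add : ∀ φ ψ p → L (λ m → φ m ℤ.+ ψ m) p ≡ L φ p ℤ.+ L ψ p
L-add φ ψ [] = refl
L-add φ ψ ((c , m) ∷ p) =
  trans (cong (ℤ._+_ (c ℤ.* (φ m ℤ.+ ψ m))) (L-add φ ψ p)) (rearrange c (φ m) (ψ m) (L φ p) (L ψ p))
  where
  rearrange : ∀ c a b x y → c ℤ.* (a ℤ.+ b) ℤ.+ (x ℤ.+ y) ≡ c ℤ.* a ℤ.+ x ℤ.+ (c ℤ.* b ℤ.+ y)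
  rearrange = ℤSolver.solve-∀

L-scale : ∀ k φ p → L (λ m → k ℤ.* φ m) p ≡ k ℤ.* L φ p
L-scale k φ [] = sym (ℤP.*-zeroʳ k)
L-scale k φ ((c , m) ∷ p) =
  trans (cong (ℤ._+_ (c ℤ.* (k ℤ.* φ m))) (L-scale k φ p)) (rearrange c k (φ m) (L φ p))
  where
  rearrange : ∀ c k a x → c ℤ.* (k ℤ.* a) ℤ.+ k ℤ.* x ≡ k ℤ.* (c ℤ.* a ℤ.+ x)
  rearrange = ℤSolver.solve-∀

L-swap : ∀ (F : Mono → Mono → ℤ) p q →
         L (λ m → L (F m) q) p ≡ L (λ m' → L (λ m → F m m') p) q
L-swap F [] q = sym (L-zero q)
L-swap F ((c , m) ∷ p) q = begin
  c ℤ.* L (F m) q ℤ.+ L (λ m → L (F m) q) p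
    ≡⟨ cong₂ ℤ._+_ (sym (L-scale c (F m) q)) (L-swap F p q) ⟩
  L (λ m' → c ℤ.* F m m') q ℤ.+ L (λ m' → L (λ m → F m m') p) q
    ≡⟨ sym (L-add (λ m' → c ℤ.* F m m') _ q) ⟩
  L (λ m' → c ℤ.* F m m' ℤ.+ L (λ m → F m m') p) q ∎
  where open ≡-Reasoning

-- Turns multiplication into an iterated pairing through `⊕`, so that associativity and, together
-- with `L-swap`, commutativity are inherited from `⊕`.
L-*P : ∀ φ p q → L φ (p *P q) ≡ L (λ m → L (λ m' → φ (m ⊕ m')) q) p
L-*P φ [] q = refl
L-*P φ ((c , m) ∷ p) q =
  trans (L-++ φ (map (mulM (c , m)) q) (p *P q)) (cong₂ ℤ._+_ (L-mulM q) (L-*P φ p q))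
  where
  rearrange : ∀ c c' a x → c ℤ.* c' ℤ.* a ℤ.+ c ℤ.* x ≡ c ℤ.* (c' ℤ.* a ℤ.+ x)
  rearrange = ℤSolver.solve-∀
  L-mulM : ∀ q → L φ (map (mulM (c , m)) q) ≡ c ℤ.* L (λ m' → φ (m ⊕ m')) q
  L-mulM [] = sym (ℤP.*-zeroʳ c)
  L-mulM ((c' , m') ∷ q) =
    trans (cong (ℤ._+_ (c ℤ.* c' ℤ.* φ (m ⊕ m'))) (L-mulM q)) (rearrange c c' (φ (m ⊕ m')) _)

L-cst*P : ∀ φ c p → L φ (cst c *P p) ≡ c ℤ.* L φ p
L-cst*P φ c p = trans (L-*P φ (cst c) p) (ℤP.+-identityʳ _)

+P-cong : ∀ {p q r s} → p ≃ q → r ≃ s → p +P r ≃ q +P s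
+P-cong {p} {q} {r} {s} h k = pairing λ φ →
  trans (L-++ φ p r) (trans (cong₂ ℤ._+_ (pair h φ) (pair k φ)) (sym (L-++ φ q s)))

*P-cong : ∀ {p q r s} → p ≃ q → r ≃ s → p *P r ≃ q *P s
*P-cong {p} {q} {r} {s} h k = pairing λ φ → begin
  L φ (p *P r)                            ≡⟨ L-*P φ p r ⟩
  L (λ m → L (λ m' → φ (m ⊕ m')) r) p     ≡⟨ L-cong (λ m → pair k _) p ⟩
  L (λ m → L (λ m' → φ (m ⊕ m')) s) p     ≡⟨ pair h _ ⟩
  L (λ m → L (λ m' → φ (m ⊕ m')) s) q     ≡⟨ sym (L-*P φ q s) ⟩
  L φ (q *P s)                            ∎
  where open ≡-Reasoning

*P-comm : ∀ p q → p *P q ≃ q *P p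
*P-comm p q = pairing λ φ → begin
  L φ (p *P q)                            ≡⟨ L-*P φ p q ⟩
  L (λ m → L (λ m' → φ (m ⊕ m')) q) p     ≡⟨ L-swap (λ m m' → φ (m ⊕ m')) p q ⟩
  L (λ m' → L (λ m → φ (m ⊕ m')) p) q     ≡⟨ L-cong (λ m' → L-cong (λ m → cong φ (⊕-comm m m')) p) q ⟩
  L (λ m' → L (λ m → φ (m' ⊕ m)) p) q     ≡⟨ sym (L-*P φ q p) ⟩
  L φ (q *P p)                            ∎
  where open ≡-Reasoning

*P-assoc : ∀ p q r → (p *P q) *P r ≃ p *P (q *P r)
*P-assoc p q r = pairing λ φ → begin
  L φ ((p *P q) *P r)
    ≡⟨ L-*P φ (p *P q) r ⟩
  L (λ m → L (λ m' → φ (m ⊕ m')) r) (p *P q)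
    ≡⟨ L-*P _ p q ⟩
  L (λ m → L (λ m' → L (λ m'' → φ ((m ⊕ m') ⊕ m'')) r) q) p
    ≡⟨ L-cong (λ m → L-cong (λ m' → L-cong (λ m'' → cong φ (⊕-assoc m m' m'')) r) q) p ⟩
  L (λ m → L (λ m' → L (λ m'' → φ (m ⊕ (m' ⊕ m''))) r) q) p
    ≡⟨ L-cong (λ m → sym (L-*P _ q r)) p ⟩
  L (λ m → L (λ m' → φ (m ⊕ m')) (q *P r)) p
    ≡⟨ sym (L-*P φ p (q *P r)) ⟩
  L φ (p *P (q *P r)) ∎
  where open ≡-Reasoning

-- A semiring is enough for the solver calls: the constant `- + 1` of `shift` occurs in them only
-- inside atoms.
polySemiring : CommutativeSemiring _ _
polySemiring = record
  { Carrier = Poly ; _≈_ = _≃_ ; _+_ = _+P_ ; _*_ = _*P_ ; 0# = [] ; 1# = cst (+ 1)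
  ; isCommutativeSemiring = isCommutativeSemiringˡ record
    { +-isCommutativeMonoid = isCommutativeMonoidˡ record
      { isSemigroup = record
        { isMagma = record { isEquivalence = ≃-isEquivalence ; ∙-cong = +P-cong }
        ; assoc = λ p q r → ≡⇒≃ (++-assoc p q r) }
      ; identityˡ = λ p → ≃-refl
      ; comm = λ p q → pairing λ φ → trans (L-++ φ p q) (trans (ℤP.+-comm (L φ p) _) (sym (L-++ φ q p))) }
    ; *-isCommutativeMonoid = isCommutativeMonoidˡ record
      { isSemigroup = record
        { isMagma = record { isEquivalence = ≃-isEquivalence ; ∙-cong = *P-cong }
        ; assoc = *P-assoc }
      ; identityˡ = λ p → pairing λ φ → trans (L-cst*P φ (+ 1) p) (ℤP.*-identityˡ _)
      ; comm = *P-comm }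
    ; distribʳ = λ r p q → pairing λ φ → begin
        L φ ((p ++ q) *P r)                  ≡⟨ L-*P φ (p ++ q) r ⟩
        _                                    ≡⟨ L-++ _ p q ⟩
        _                                    ≡⟨ sym (cong₂ ℤ._+_ (L-*P φ p r) (L-*P φ q r)) ⟩
        L φ (p *P r) ℤ.+ L φ (q *P r)        ≡⟨ sym (L-++ φ (p *P r) _) ⟩
        L φ (p *P r +P q *P r)               ∎
    ; zeroˡ = λ p → ≃-refl } }
  where
  open ≡-Reasoning
  open import Algebra.Structures.Biased {A = Poly} _≃_
  open import Data.List.Properties using (++-assoc)
  open import Relation.Binary.Structures using (IsEquivalence)
  ≃-refl : ∀ {p} → p ≃ p
  ≃-refl = pairing λ φ → refl
  ≡⇒≃ : ∀ {p q} → p ≡ q → p ≃ q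
  ≡⇒≃ refl = ≃-refl
  ≃-isEquivalence : IsEquivalence _≃_
  ≃-isEquivalence = record
    { refl = ≃-refl
    ; sym = λ h → pairing λ φ → sym (pair h φ)
    ; trans = λ h k → pairing λ φ → trans (pair h φ) (pair k φ) }

module P = CommutativeSemiring polySemiring

infixr 5 _+ˡ_ _*ˡ_
infixl 5 _+ʳ_ _*ʳ_

_+ˡ_ : ∀ p {q r} → q ≃ r → p +P q ≃ p +P r
p +ˡ h = P.+-cong (P.refl {p}) h

_+ʳ_ : ∀ {p q} → p ≃ q → ∀ r → p +P r ≃ q +P r
h +ʳ r = P.+-cong h (P.refl {r})

_*ˡ_ : ∀ p {q r} → q ≃ r → p *P q ≃ p *P r
p *ˡ h = P.*-cong (P.refl {p}) h

_*ʳ_ : ∀ {p q} → p ≃ q → ∀ r → p *P r ≃ q *P r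
h *ʳ r = P.*-cong h (P.refl {r})

open import Algebra.Solver.Ring.NaturalCoefficients polySemiring (λ _ _ → nothing) using (solve; _:+_; _:*_; _:=_; con)
import Relation.Binary.Reasoning.Setoid P.setoid as ≃R

cst-+ : ∀ j k → cst (+ (j ℕ.+ k)) ≃ cst (+ j) +P cst (+ k)
cst-+ j k = pairing λ φ → distrib (+ j) (+ k) (φ _)
  where
  distrib : ∀ j k a → (j ℤ.+ k) ℤ.* a ℤ.+ + 0 ≡ j ℤ.* a ℤ.+ (k ℤ.* a ℤ.+ + 0)
  distrib = ℤSolver.solve-∀

cst-zero : cst (+ 0) ≃ []
cst-zero = pairing λ φ → refl

cst-suc : ∀ k → cst (+ suc k) ≃ P.1# +P cst (+ k)
cst-suc = cst-+ 1

-- The Euler operator y ∂/∂y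

θ : Poly → Poly
θ p = Y *P dY p

-- `θ` is diagonal on monomials, with the exponent of y as eigenvalue. Linearity and the Leibniz
-- rule are read off from this form.
L-θ : ∀ φ p → L φ (θ p) ≡ L (λ { (a , b , d , e) → + b ℤ.* φ (a , b , d , e) }) p
L-θ φ p = trans (L-*P φ Y (dY p)) (trans (ℤP.+-identityʳ _) (trans (ℤP.*-identityˡ _) (go p)))
  where
  go : ∀ p → L (λ m' → φ ((0 , 1 , 0 , 0) ⊕ m')) (dY p)
           ≡ L (λ { (a , b , d , e) → + b ℤ.* φ (a , b , d , e) }) p
  go [] = refl
  -- The truncated exponent makes the two monomials differ here, but both carry a factor `+ 0`, and
  -- `+ 0 ℤ.* _` reduces to `+ 0`.
  go ((c , a , zero , d , e) ∷ p) =
    cong₂ ℤ._+_ (ℤP.*-assoc c (+ 0) (φ _)) (go p)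
  go ((c , a , suc b , d , e) ∷ p) =
    cong₂ ℤ._+_ (ℤP.*-assoc c (+ suc b) (φ _)) (go p)

θ-cong : ∀ {p q} → p ≃ q → θ p ≃ θ q
θ-cong {p} {q} h = pairing λ φ → trans (L-θ φ p) (trans (pair h _) (sym (L-θ φ q)))

θ-+P : ∀ p q → θ (p +P q) ≃ θ p +P θ q
θ-+P p q = pairing λ φ → trans (L-θ φ (p +P q)) (trans (L-++ _ p q)
  (trans (sym (cong₂ ℤ._+_ (L-θ φ p) (L-θ φ q))) (sym (L-++ φ (θ p) (θ q)))))

-- The exponent of y is additive under `⊕`, so the eigenvalue of a product of monomials splits into
-- one summand per factor.
θ-*P : ∀ p q → θ (p *P q) ≃ θ p *P q +P p *P θ q
θ-*P p q = pairing λ φ →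
  let w : Mono → ℤ
      w = λ { (a , b , d , e) → + b ℤ.* φ (a , b , d , e) }
      split : ∀ m m' → w (m ⊕ m') ≡ + y m ℤ.* φ (m ⊕ m') ℤ.+ + y m' ℤ.* φ (m ⊕ m')
      split = λ { (a , b , d , e) (a' , b' , d' , e') → ℤP.*-distribʳ-+ (φ _) (+ b) (+ b') }
  in begin
  L φ (θ (p *P q))
    ≡⟨ trans (L-θ φ (p *P q)) (L-*P w p q) ⟩
  L (λ m → L (λ m' → w (m ⊕ m')) q) p
    ≡⟨ L-cong (λ m → trans (L-cong (split m) q) (L-add (λ m' → + y m ℤ.* φ (m ⊕ m')) _ q)) p ⟩
  L (λ m → L (λ m' → + y m ℤ.* φ (m ⊕ m')) q ℤ.+ L (λ m' → + y m' ℤ.* φ (m ⊕ m')) q) p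
    ≡⟨ L-add (λ m → L (λ m' → + y m ℤ.* φ (m ⊕ m')) q) _ p ⟩
  L (λ m → L (λ m' → + y m ℤ.* φ (m ⊕ m')) q) p ℤ.+ L (λ m → L (λ m' → + y m' ℤ.* φ (m ⊕ m')) q) p
    ≡⟨ cong₂ ℤ._+_ (L-cong (λ m → L-scale (+ y m) (λ m' → φ (m ⊕ m')) q) p)
                   (L-cong (λ m → sym (L-θ (λ m' → φ (m ⊕ m')) q)) p) ⟩
  L (λ m → + y m ℤ.* L (λ m' → φ (m ⊕ m')) q) p ℤ.+ L (λ m → L (λ m' → φ (m ⊕ m')) (θ q)) p
    ≡⟨ sym (cong₂ ℤ._+_ (trans (L-*P φ (θ p) q) (L-θ _ p)) (L-*P φ p (θ q))) ⟩
  L φ (θ p *P q) ℤ.+ L φ (p *P θ q)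
    ≡⟨ sym (L-++ φ (θ p *P q) (p *P θ q)) ⟩
  L φ (θ p *P q +P p *P θ q) ∎
  where
  open ≡-Reasoning
  y : Mono → ℕ
  y (a , b , d , e) = b

U : Poly
U = Y +P T

θ-U : θ U ≃ Y
θ-U = pairing λ φ → refl

θ-const-pow : ∀ p → θ p ≃ [] → ∀ k → θ (powP p k) ≃ []
θ-const-pow p h zero = pairing λ φ → refl
θ-const-pow p h (suc k) = begin
  θ (p *P powP p k)                       ≈⟨ θ-*P p (powP p k) ⟩
  θ p *P powP p k +P p *P θ (powP p k)    ≈⟨ P.+-cong (h *ʳ powP p k) (p *ˡ θ-const-pow p h k) ⟩
  [] *P powP p k +P p *P []               ≈⟨ P.+-cong (P.zeroˡ (powP p k)) (P.zeroʳ p) ⟩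
  []                                      ∎
  where open ≃R

θ-Y : θ Y ≃ Y
θ-Y = pairing λ φ → refl

θ-powY : ∀ k → θ (powP Y k) ≃ cst (+ k) *P powP Y k
θ-powY zero = pairing λ φ → refl
θ-powY (suc k) = begin
  θ (Y *P powP Y k)                              ≈⟨ θ-*P Y (powP Y k) ⟩
  θ Y *P powP Y k +P Y *P θ (powP Y k)           ≈⟨ P.+-cong (θ-Y *ʳ powP Y k) (Y *ˡ θ-powY k) ⟩
  Y *P powP Y k +P Y *P (cst (+ k) *P powP Y k)  ≈⟨ solve 3 (λ y w c → y :* w :+ y :* (c :* w) := (con 1 :+ c) :* (y :* w)) P.refl Y (powP Y k) (cst (+ k)) ⟩
  (P.1# +P cst (+ k)) *P (Y *P powP Y k)         ≈⟨ P.sym (cst-suc k) *ʳ (Y *P powP Y k) ⟩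
  cst (+ suc k) *P (Y *P powP Y k)               ∎
  where open ≃R

-- Multiplied by U so that no exponent k ∸ 1 appears.
U*θ-powU : ∀ k → U *P θ (powP U k) ≃ cst (+ k) *P (Y *P powP U k)
U*θ-powU zero = pairing λ φ → refl
U*θ-powU (suc k) = begin
  U *P θ (U *P powP U k)
    ≈⟨ U *ˡ θ-*P U (powP U k) ⟩
  U *P (θ U *P powP U k +P U *P θ (powP U k))
    ≈⟨ U *ˡ P.+-cong (θ-U *ʳ powP U k) (U*θ-powU k) ⟩
  U *P (Y *P powP U k +P cst (+ k) *P (Y *P powP U k))
    ≈⟨ solve 4 (λ y w c u → u :* (y :* w :+ c :* (y :* w)) := (con 1 :+ c) :* (y :* (u :* w))) P.refl Y (powP U k) (cst (+ k)) U ⟩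
  (P.1# +P cst (+ k)) *P (Y *P (U *P powP U k))
    ≈⟨ P.sym (cst-suc k) *ʳ (Y *P (U *P powP U k)) ⟩
  cst (+ suc k) *P (Y *P (U *P powP U k)) ∎
  where open ≃R

-- The second variable is `U` rather than `T`: `θ` sends `U` to `Y`, and the substitution leaves `U`
-- fixed.
mon : ℕ → ℕ → ℕ → ℕ → Poly
mon a b d l = powP Y a *P powP U b *P powP X d *P powP Z l

op-cong : ∀ n {p q} → p ≃ q → op n p ≃ op n q
op-cong n h = P.+-cong ((X +P cst (+ n) *P Z) *ˡ h) (U *ˡ P.+-cong (cst (+ n) *ˡ h) (θ-cong h))

op-[] : ∀ n → op n [] ≃ []
op-[] n = P.trans (P.+-cong (P.zeroʳ (X +P cst (+ n) *P Z)) (P.zeroʳ U)) P.refl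

op-+P : ∀ n p q → op n (p +P q) ≃ op n p +P op n q
op-+P n p q = begin
  C *P (p +P q) +P U *P (cst (+ n) *P (p +P q) +P θ (p +P q))
    ≈⟨ C *P (p +P q) +ˡ U *ˡ cst (+ n) *P (p +P q) +ˡ θ-+P p q ⟩
  C *P (p +P q) +P U *P (cst (+ n) *P (p +P q) +P (θ p +P θ q))
    ≈⟨ solve 7 (λ c u k p q p' q' → c :* (p :+ q) :+ u :* (k :* (p :+ q) :+ (p' :+ q'))
          := c :* p :+ u :* (k :* p :+ p') :+ (c :* q :+ u :* (k :* q :+ q')))
          P.refl C U (cst (+ n)) p q (θ p) (θ q) ⟩
  op n p +P op n q ∎
  where
  open ≃R
  C = X +P cst (+ n) *P Z

-- Differentiating `powP U b` lowers its exponent, but the outer factor `U` of `op` restores it. The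
-- net effect is to multiply by `Y` with coefficient `b`.
op-mon : ∀ n a b d l → op n (mon a b d l) ≃
  mon a b (suc d) l +P cst (+ n) *P mon a b d (suc l)
  +P (cst (+ (n ℕ.+ a)) *P mon a (suc b) d l +P cst (+ b) *P mon (suc a) b d l)
op-mon n a b d l = begin
  C *P (A' *P B' *P D' *P E') +P U *P (N' *P (A' *P B' *P D' *P E') +P θ (A' *P B' *P D' *P E'))
    ≈⟨ C *P (A' *P B' *P D' *P E') +ˡ U *ˡ N' *P (A' *P B' *P D' *P E') +ˡ θ-mon ⟩
  C *P (A' *P B' *P D' *P E') +P U *P (N' *P (A' *P B' *P D' *P E') +P
      (cst (+ a) *P A' *P B' +P A' *P θ B') *P D' *P E')
    ≈⟨ solve 11 (λ x z u n k a b b' d e y →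
         (x :+ n :* z) :* (a :* b :* d :* e) :+ u :* (n :* (a :* b :* d :* e) :+ (k :* a :* b :+ a :* b') :* d :* e)
         := (a :* b :* (x :* d) :* e :+ n :* (a :* b :* d :* (z :* e))) :+
            ((n :+ k) :* (a :* (u :* b) :* d :* e) :+ a :* (u :* b') :* d :* e))
       P.refl X Z U N' (cst (+ a)) A' B' (θ B') D' E' Y ⟩
  mon a b (suc d) l +P cst (+ n) *P mon a b d (suc l) +P
    ((N' +P cst (+ a)) *P mon a (suc b) d l +P A' *P (U *P θ B') *P D' *P E')
    ≈⟨ (mon a b (suc d) l +P cst (+ n) *P mon a b d (suc l)) +ˡ
         P.+-cong (P.sym (cst-+ n a) *ʳ mon a (suc b) d l) ((A' *ˡ U*θ-powU b) *ʳ D' *ʳ E') ⟩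
  mon a b (suc d) l +P cst (+ n) *P mon a b d (suc l) +P
    (cst (+ (n ℕ.+ a)) *P mon a (suc b) d l +P A' *P (cst (+ b) *P (Y *P B')) *P D' *P E')
    ≈⟨ (mon a b (suc d) l +P cst (+ n) *P mon a b d (suc l)) +ˡ
         cst (+ (n ℕ.+ a)) *P mon a (suc b) d l +ˡ
         (solve 6 (λ a k y b d e → a :* (k :* (y :* b)) :* d :* e := k :* (y :* a :* b :* d :* e))
            P.refl A' (cst (+ b)) Y B' D' E') ⟩
  mon a b (suc d) l +P cst (+ n) *P mon a b d (suc l) +P
    (cst (+ (n ℕ.+ a)) *P mon a (suc b) d l +P cst (+ b) *P mon (suc a) b d l) ∎
  where
  open ≃R
  N' = cst (+ n)
  C = X +P N' *P Z
  A' = powP Y a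
  B' = powP U b
  D' = powP X d
  E' = powP Z l
  θ-mon : θ (A' *P B' *P D' *P E') ≃ (cst (+ a) *P A' *P B' +P A' *P θ B') *P D' *P E'
  θ-mon = begin
    θ (A' *P B' *P D' *P E')
      ≈⟨ θ-*P (A' *P B' *P D') E' ⟩
    θ (A' *P B' *P D') *P E' +P A' *P B' *P D' *P θ E'
      ≈⟨ P.+-cong (θ-*P (A' *P B') D' *ʳ E') (A' *P B' *P D' *ˡ θ-const-pow Z (pairing λ φ → refl) l) ⟩
    (θ (A' *P B') *P D' +P A' *P B' *P θ D') *P E' +P A' *P B' *P D' *P []
      ≈⟨ (P.+-cong (θ-*P A' B' *ʳ D') (A' *P B' *ˡ θ-const-pow X (pairing λ φ → refl) d) *ʳ E') +ʳ A' *P B' *P D' *P [] ⟩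
    ((θ A' *P B' +P A' *P θ B') *P D' +P A' *P B' *P []) *P E' +P A' *P B' *P D' *P []
      ≈⟨ ((((θ-powY a *ʳ B') +ʳ A' *P θ B') *ʳ D') +ʳ A' *P B' *P [] *ʳ E') +ʳ A' *P B' *P D' *P [] ⟩
    ((cst (+ a) *P A' *P B' +P A' *P θ B') *P D' +P A' *P B' *P []) *P E' +P A' *P B' *P D' *P []
      ≈⟨ solve 6 (λ k a b b' d e → ((k :* a :* b :+ a :* b') :* d :+ a :* b :* con 0) :* e :+ a :* b :* d :* con 0
                   := (k :* a :* b :+ a :* b') :* d :* e) P.refl (cst (+ a)) A' B' (θ B') D' E' ⟩
    (cst (+ a) *P A' *P B' +P A' *P θ B') *P D' *P E' ∎

-- The substitution y ↦ y + 1, t ↦ t − 1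

shiftMono : Mono → Poly
shiftMono (a , b , d , e) = powP X a *P powP (Y +P cst (+ 1)) b *P powP Z d *P powP (T +P cst (- + 1)) e

L-shift : ∀ φ p → L φ (shift p) ≡ L (λ m → L φ (shiftMono m)) p
L-shift φ [] = refl
L-shift φ ((c , a , b , d , e) ∷ p) =
  trans (L-++ φ (cst c *P A' *P B' *P D' *P E') (shift p)) (cong₂ ℤ._+_
    (trans (pair assoc φ) (L-cst*P φ c (A' *P B' *P D' *P E'))) (L-shift φ p))
  where
  A' = powP X a
  B' = powP (Y +P cst (+ 1)) b
  D' = powP Z d
  E' = powP (T +P cst (- + 1)) e
  assoc : cst c *P A' *P B' *P D' *P E' ≃ cst c *P (A' *P B' *P D' *P E')
  assoc = solve 5 (λ c a b d e → c :* a :* b :* d :* e := c :* (a :* b :* d :* e)) P.refl (cst c) A' B' D' E'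

shift-cong : ∀ {p q} → p ≃ q → shift p ≃ shift q
shift-cong {p} {q} h = pairing λ φ → trans (L-shift φ p) (trans (pair h _) (sym (L-shift φ q)))

shift-+P : ∀ p q → shift (p +P q) ≃ shift p +P shift q
shift-+P p q = pairing λ φ → trans (L-shift φ (p +P q)) (trans (L-++ _ p q)
  (trans (sym (cong₂ ℤ._+_ (L-shift φ p) (L-shift φ q))) (sym (L-++ φ (shift p) (shift q)))))

powP-+ : ∀ p j k → powP p (j ℕ.+ k) ≃ powP p j *P powP p k
powP-+ p zero k = P.sym (P.*-identityˡ (powP p k))
powP-+ p (suc j) k = P.trans (p *ˡ powP-+ p j k) (P.sym (P.*-assoc p (powP p j) (powP p k)))

powP-cong : ∀ {p q} → p ≃ q → ∀ k → powP p k ≃ powP q k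
powP-cong h zero = P.refl
powP-cong h (suc k) = P.*-cong h (powP-cong h k)

shiftMono-⊕ : ∀ m m' → shiftMono (m ⊕ m') ≃ shiftMono m *P shiftMono m'
shiftMono-⊕ (a , b , d , e) (a' , b' , d' , e') = P.trans
  (P.*-cong (P.*-cong (P.*-cong (powP-+ X a a') (powP-+ Y₁ b b')) (powP-+ Z d d')) (powP-+ T₁ e e'))
  (solve 8 (λ a a' b b' d d' e e' → (a :* a') :* (b :* b') :* (d :* d') :* (e :* e')
     := (a :* b :* d :* e) :* (a' :* b' :* d' :* e')) P.refl
     (powP X a) (powP X a') (powP Y₁ b) (powP Y₁ b') (powP Z d) (powP Z d') (powP T₁ e) (powP T₁ e'))
  where
  Y₁ = Y +P cst (+ 1)
  T₁ = T +P cst (- + 1)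

shift-*P : ∀ p q → shift (p *P q) ≃ shift p *P shift q
shift-*P p q = pairing λ φ → begin
  L φ (shift (p *P q))
    ≡⟨ trans (L-shift φ (p *P q)) (L-*P _ p q) ⟩
  L (λ m → L (λ m' → L φ (shiftMono (m ⊕ m'))) q) p
    ≡⟨ L-cong (λ m → L-cong (λ m' → pair (P.trans (shiftMono-⊕ m m') (P.*-comm (shiftMono m) (shiftMono m'))) φ) q) p ⟩
  L (λ m → L (λ m' → L φ (shiftMono m' *P shiftMono m)) q) p
    ≡⟨ L-cong (λ m → L-cong (λ m' → L-*P φ (shiftMono m') (shiftMono m)) q) p ⟩
  L (λ m → L (λ m' → L (λ m₁ → L (λ m₂ → φ (m₁ ⊕ m₂)) (shiftMono m)) (shiftMono m')) q) p
    ≡⟨ L-cong (λ m → sym (trans (L-*P φ (shift q) (shiftMono m)) (L-shift _ q))) p ⟩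
  L (λ m → L φ (shift q *P shiftMono m)) p
    ≡⟨ L-cong (λ m → trans (pair (P.*-comm (shift q) (shiftMono m)) φ) (L-*P φ (shiftMono m) (shift q))) p ⟩
  L (λ m → L (λ m₁ → L (λ m₂ → φ (m₁ ⊕ m₂)) (shift q)) (shiftMono m)) p
    ≡⟨ sym (trans (L-*P φ (shift p) (shift q)) (L-shift _ p)) ⟩
  L φ (shift p *P shift q) ∎
  where open ≡-Reasoning

shift-powP : ∀ p q → shift p ≃ q → ∀ k → shift (powP p k) ≃ powP q k
shift-powP p q h zero = pairing λ φ → refl
shift-powP p q h (suc k) = P.trans (shift-*P p (powP p k)) (P.*-cong h (shift-powP p q h k))

-- `U` is invariant because (y + 1) + (t - 1) = y + t; this is the cancellation checked on paired
-- values by `cancel`.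
shift-mon : ∀ a b d l → shift (mon a b d l) ≃
  powP (Y +P cst (+ 1)) a *P powP U b *P powP X d *P powP Z l
shift-mon a b d l =
  P.trans (shift-*P (powP Y a *P powP U b *P powP X d) (powP Z l)) (P.*-cong
  (P.trans (shift-*P (powP Y a *P powP U b) (powP X d)) (P.*-cong
  (P.trans (shift-*P (powP Y a) (powP U b)) (P.*-cong
    (shift-powP Y _ (pairing λ φ → refl) a)
    (shift-powP U U (pairing λ φ → cancel (φ (0 , 1 , 0 , 0)) (φ (0 , 0 , 0 , 0)) (φ (0 , 0 , 0 , 1))) b)))
    (shift-powP X X (pairing λ φ → refl) d)))
    (shift-powP Z Z (pairing λ φ → refl) l))
  where
  cancel : ∀ y o t → + 1 ℤ.* y ℤ.+ (+ 1 ℤ.* o ℤ.+ (+ 1 ℤ.* t ℤ.+ (- + 1 ℤ.* o ℤ.+ + 0))) ≡ + 1 ℤ.* y ℤ.+ (+ 1 ℤ.* t ℤ.+ + 0)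
  cancel = ℤSolver.solve-∀

-- Finite sums of polynomials

sumOver : (A → Poly) → List A → Poly
sumOver w xs = sumP (map w xs)

sumOver-cong : ∀ {w v : A → Poly} xs → (∀ {x} → x ∈ xs → w x ≃ v x) → sumOver w xs ≃ sumOver v xs
sumOver-cong [] h = P.refl
sumOver-cong (x ∷ xs) h = P.+-cong (h (here refl)) (sumOver-cong xs (λ i → h (there i)))

sumOver-↭ : ∀ (w : A → Poly) {xs ys} → xs ↭ ys → sumOver w xs ≃ sumOver w ys
sumOver-↭ w Perm.refl = P.refl
sumOver-↭ w (Perm.prep x h) = w x +ˡ sumOver-↭ w h
sumOver-↭ w (Perm.swap {xs} {ys} x y h) = P.trans
  (solve 3 (λ a b c → a :+ (b :+ c) := b :+ (a :+ c)) P.refl (w x) (w y) (sumOver w xs))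
  (w y +ˡ w x +ˡ sumOver-↭ w h)
sumOver-↭ w (Perm.trans h k) = P.trans (sumOver-↭ w h) (sumOver-↭ w k)

sumOver-++ : ∀ (w : A → Poly) xs ys → sumOver w (xs ++ ys) ≃ sumOver w xs +P sumOver w ys
sumOver-++ w [] ys = P.refl
sumOver-++ w (x ∷ xs) ys = P.trans (w x +ˡ sumOver-++ w xs ys) (P.sym (P.+-assoc (w x) (sumOver w xs) (sumOver w ys)))

sumOver-map : ∀ (w : B → Poly) (f : A → B) xs → sumOver w (map f xs) ≡ sumOver (λ x → w (f x)) xs
sumOver-map w f [] = refl
sumOver-map w f (x ∷ xs) = cong (w (f x) +P_) (sumOver-map w f xs)

sumOver-concatMap : ∀ (w : B → Poly) (f : A → List B) xs →
  sumOver w (concatMap f xs) ≃ sumOver (λ x → sumOver w (f x)) xs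
sumOver-concatMap w f [] = P.refl
sumOver-concatMap w f (x ∷ xs) = P.trans (sumOver-++ w (f x) (concatMap f xs)) (sumOver w (f x) +ˡ sumOver-concatMap w f xs)

sumOver-const : ∀ p (xs : List A) → sumOver (λ _ → p) xs ≃ cst (+ length xs) *P p
sumOver-const p [] = P.sym (P.trans (cst-zero *ʳ p) (P.zeroˡ p))
sumOver-const p (x ∷ xs) = begin
  p +P sumOver (λ _ → p) xs          ≈⟨ p +ˡ sumOver-const p xs ⟩
  p +P cst (+ length xs) *P p        ≈⟨ solve 2 (λ p c → p :+ c :* p := (con 1 :+ c) :* p) P.refl p (cst (+ length xs)) ⟩
  (P.1# +P cst (+ length xs)) *P p   ≈⟨ P.sym (cst-suc (length xs)) *ʳ p ⟩
  cst (+ suc (length xs)) *P p       ∎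
  where open ≃R

sumOver-op : ∀ n (w : A → Poly) xs → op n (sumOver w xs) ≃ sumOver (λ x → op n (w x)) xs
sumOver-op n w [] = op-[] n
sumOver-op n w (x ∷ xs) = P.trans (op-+P n (w x) (sumOver w xs)) (op n (w x) +ˡ sumOver-op n w xs)

sumOver-shift : ∀ (w : A → Poly) xs → shift (sumOver w xs) ≃ sumOver (λ x → shift (w x)) xs
sumOver-shift w [] = P.refl
sumOver-shift w (x ∷ xs) = P.trans (shift-+P (w x) (sumOver w xs)) (shift (w x) +ˡ sumOver-shift w xs)

-- Booleans and decidable propositions

does-true : ∀ {P : Set} (P? : Dec P) → does P? ≡ true → P
does-true (yes x) _ = x

false≢true : false ≢ true
false≢true ()

bool-ext : ∀ {b c : Bool} → (b ≡ true → c ≡ true) → (c ≡ true → b ≡ true) → b ≡ c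
bool-ext {false} {false} f g = refl
bool-ext {false} {true}  f g = g refl
bool-ext {true}  {c}     f g = sym (f refl)

∧-true : ∀ {b c} → b ∧ c ≡ true → b ≡ true × c ≡ true
∧-true {true} {true} refl = refl , refl

<ᵇ-true : ∀ {m n} → m < n → (m <ᵇ n) ≡ true
<ᵇ-true {m} {n} h = dec-true (m ℕP.<? n) h

<ᵇ-sound : ∀ m n → (m <ᵇ n) ≡ true → m < n
<ᵇ-sound m n = does-true (m ℕP.<? n)

<ᵇ-false : ∀ {m n} → n ≤ m → (m <ᵇ n) ≡ false
<ᵇ-false {m} {n} h = dec-false (m ℕP.<? n) (ℕP.≤⇒≯ h)

-- Iterating a map

-- The ancestor relation without the step bounds of `Desc` and `IsTree`; those bounds depend on the
-- size of the tree and would obstruct passing between trees of different sizes.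
data Anc (f : A → A) : A → A → Set where
  here : ∀ {w} → Anc f w w
  up   : ∀ {w v} → Anc f (f w) v → Anc f w v

Anc-trans : ∀ {f : A → A} {w v u} → Anc f w v → Anc f v u → Anc f w u
Anc-trans here   b = b
Anc-trans (up a) b = up (Anc-trans a b)

Anc-cong : ∀ {f g : A → A} → (∀ x → f x ≡ g x) → ∀ {w v} → Anc f w v → Anc g w v
Anc-cong h here = here
Anc-cong {g = g} h {w} {v} (up a) = up (subst (λ x → Anc g x v) (h w) (Anc-cong h a))

Anc-comparable : ∀ {f : A → A} {w a b} → Anc f w a → Anc f w b → Anc f a b ⊎ Anc f b a
Anc-comparable here   b      = inj₁ b
Anc-comparable (up a) here   = inj₂ (up a)
Anc-comparable (up a) (up b) = Anc-comparable a b

iter-comm : ∀ (f : A → A) k x → iter f k (f x) ≡ f (iter f k x)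
iter-comm f zero x = refl
iter-comm f (suc k) x = cong f (iter-comm f k x)

iter-+ : ∀ (f : A → A) j k x → iter f (j ℕ.+ k) x ≡ iter f j (iter f k x)
iter-+ f zero k x = refl
iter-+ f (suc j) k x = cong f (iter-+ f j k x)

iter-fixed : ∀ (f : A → A) {x} → f x ≡ x → ∀ k → iter f k x ≡ x
iter-fixed f h zero = refl
iter-fixed f h (suc k) = trans (cong f (iter-fixed f h k)) h

iter-* : ∀ (f : A → A) m {x} → iter f m x ≡ x → ∀ r → iter f (r ℕ.* m) x ≡ x
iter-* f m h zero = refl
iter-* f m {x} h (suc r) = trans (iter-+ f m (r ℕ.* m) x) (trans (cong (iter f m) (iter-* f m h r)) h)

iter⇒Anc : ∀ (f : A → A) k w → Anc f w (iter f k w)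
iter⇒Anc f zero w = here
iter⇒Anc f (suc k) w = up (subst (Anc f (f w)) (iter-comm f k w) (iter⇒Anc f k (f w)))

Anc⇒iter : ∀ {f : A → A} {w v} → Anc f w v → ∃ λ k → iter f k w ≡ v
Anc⇒iter here = 0 , refl
Anc⇒iter {f = f} {w} (up a) with Anc⇒iter a
... | k , e = suc k , trans (sym (iter-comm f k w)) e

-- Pigeonhole: an orbit in Fin m is exhausted by its first m points.
iter-short : ∀ {m} (f : Fin m → Fin m) w k → ∃ λ (j : Fin m) → iter f (toℕ j) w ≡ iter f k w
iter-short {m} f w = <-rec _ go
  where
  go : ∀ k → (∀ {k'} → k' < k → ∃ λ (j : Fin m) → iter f (toℕ j) w ≡ iter f k' w) →
       ∃ λ (j : Fin m) → iter f (toℕ j) w ≡ iter f k w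
  go k rec with k ℕP.<? m
  ... | yes k<m = fromℕ< k<m , cong (λ i → iter f i w) (FinP.toℕ-fromℕ< k<m)
  ... | no k≮m with pigeonhole (ℕP.n<1+n m) (λ (a : Fin (suc m)) → iter f (toℕ a) w)
  -- The two equal points close a loop of length `b` - `a`; cutting it out of the orbit shortens `k`
  -- to `k` - `b` + `a`.
  ... | a , b , a<b , e with rec {k ℕ.∸ toℕ b ℕ.+ toℕ a} shorter
    where
    b≤k : toℕ b ≤ k
    b≤k = ℕP.≤-trans (FinP.toℕ≤pred[n] b) (ℕP.≮⇒≥ k≮m)
    shorter : k ℕ.∸ toℕ b ℕ.+ toℕ a < k
    shorter = ℕP.<-≤-trans (ℕP.+-monoʳ-< (k ℕ.∸ toℕ b) a<b) (ℕP.≤-reflexive (ℕP.m∸n+n≡m b≤k))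
  ... | j , e' = j , trans e' (trans (iter-+ f (k ℕ.∸ toℕ b) (toℕ a) w)
        (trans (cong (iter f (k ℕ.∸ toℕ b)) e) (trans (sym (iter-+ f (k ℕ.∸ toℕ b) (toℕ b) w))
        (cong (λ i → iter f i w) (ℕP.m∸n+n≡m (ℕP.≤-trans (FinP.toℕ≤pred[n] b) (ℕP.≮⇒≥ k≮m)))))))

-- Statistics of one tree

V : ℕ → Set
V n = Fin (suc n)

lbl-injective : ∀ {n} {v w : Fin n} → lbl v ≡ lbl w → v ≡ w
lbl-injective e = FinP.toℕ-injective (ℕP.suc-injective e)

module _ {n : ℕ} (p : Parents n) where

  -- The root is its own `par`, so a path of at most `n` steps can be padded to exactly `n` steps.
  reaches⇒IsTree : (∀ v → Anc (par p) v zero) → IsTree p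
  reaches⇒IsTree h v with Anc⇒iter (h v)
  ... | k , e with iter-short (par p) v k
  ... | j , e' = begin
    iter (par p) n v                                   ≡⟨ cong (λ i → iter (par p) i v) (sym (ℕP.m∸n+n≡m (FinP.toℕ≤pred[n] j))) ⟩
    iter (par p) (n ℕ.∸ toℕ j ℕ.+ toℕ j) v             ≡⟨ iter-+ (par p) (n ℕ.∸ toℕ j) (toℕ j) v ⟩
    iter (par p) (n ℕ.∸ toℕ j) (iter (par p) (toℕ j) v) ≡⟨ cong (iter (par p) (n ℕ.∸ toℕ j)) (trans e' e) ⟩
    iter (par p) (n ℕ.∸ toℕ j) zero                    ≡⟨ iter-fixed (par p) refl (n ℕ.∸ toℕ j) ⟩
    zero ∎
    where open ≡-Reasoning

  IsTree⇒reaches : IsTree p → ∀ v → Anc (par p) v zero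
  IsTree⇒reaches t v = subst (Anc (par p) v) (t v) (iter⇒Anc (par p) n v)

  -- A cycle of length `k` + 1 through `c` returns to `c` after `n` (`k` + 1) steps; but after the
  -- first `n` of them the walk is at the root and stays there.
  acyclic : IsTree p → ∀ {c} → Anc (par p) (par p c) c → c ≡ zero
  acyclic t {c} a with Anc⇒iter a
  ... | k , e = begin
    c                                             ≡⟨ sym (iter-* (par p) (suc k) (trans (sym (iter-comm (par p) k c)) e) n) ⟩
    iter (par p) (n ℕ.* suc k) c                  ≡⟨ cong (λ i → iter (par p) i c) (trans (ℕP.*-suc n k) (ℕP.+-comm n (n ℕ.* k))) ⟩
    iter (par p) (n ℕ.* k ℕ.+ n) c                ≡⟨ iter-+ (par p) (n ℕ.* k) n c ⟩
    iter (par p) (n ℕ.* k) (iter (par p) n c)     ≡⟨ cong (iter (par p) (n ℕ.* k)) (t c) ⟩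
    iter (par p) (n ℕ.* k) zero                   ≡⟨ iter-fixed (par p) refl (n ℕ.* k) ⟩
    zero ∎
    where open ≡-Reasoning

  Anc⇒Desc : ∀ {w v} → Anc (par p) w v → Desc p v w
  Anc⇒Desc {w} a with Anc⇒iter a
  ... | k , e with iter-short (par p) w k
  ... | j , e' = j , trans e' e

  Desc⇒Anc : ∀ {w v} → Desc p v w → Anc (par p) w v
  Desc⇒Anc {w} (j , e) = subst (Anc (par p) w) e (iter⇒Anc (par p) (toℕ j) w)

  private
    β-step : V n → V n → ℕ → ℕ
    β-step v w acc = if does (desc? p v w) then ℕ._⊓_ (lbl w) acc else acc

    β-step-≤ : ∀ v w acc → β-step v w acc ≤ acc
    β-step-≤ v w acc with does (desc? p v w)
    ... | true  = ℕP.m⊓n≤n (lbl w) acc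
    ... | false = ℕP.≤-refl

    fold-lower : ∀ v xs {w} → w ∈ xs → Anc (par p) w v → foldr (β-step v) (lbl v) xs ≤ lbl w
    fold-lower v (x ∷ xs) (here refl) a rewrite dec-true (desc? p v x) (Anc⇒Desc a) = ℕP.m⊓n≤m (lbl x) _
    fold-lower v (x ∷ xs) (there i) a = ℕP.≤-trans (β-step-≤ v x _) (fold-lower v xs i a)

    fold-attained : ∀ v xs → ∃ λ w → Anc (par p) w v × lbl w ≡ foldr (β-step v) (lbl v) xs
    fold-attained v [] = v , here , refl
    fold-attained v (x ∷ xs) = go (desc? p v x)
      where
      r = foldr (β-step v) (lbl v) xs
      go : (d : Dec (Desc p v x)) → ∃ λ w → Anc (par p) w v × lbl w ≡ (if does d then ℕ._⊓_ (lbl x) r else r)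
      go (no _) = fold-attained v xs
      go (yes d) with ℕP.⊓-sel (lbl x) r
      ... | inj₁ e = x , Desc⇒Anc d , sym e
      ... | inj₂ e with fold-attained v xs
      ... | w , a , e' = w , a , trans e' (sym e)

  β-lower : ∀ {w v} → Anc (par p) w v → β p v ≤ lbl w
  β-lower {w} {v} = fold-lower v (allFin (suc n)) (∈-allFin w)

  β-attained : ∀ v → ∃ λ w → Anc (par p) w v × lbl w ≡ β p v
  β-attained v = fold-attained v (allFin (suc n))

  β-anti : ∀ {w v} → Anc (par p) w v → β p v ≤ β p w
  β-anti {w} a with β-attained w
  ... | u , b , e = ℕP.≤-trans (β-lower (Anc-trans b a)) (ℕP.≤-reflexive e)

  -- The means of computing `β` in an enlarged tree: one descendant with the right label and a bound
  -- for all others.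
  β-unique : ∀ v m → (∃ λ w → Anc (par p) w v × lbl w ≡ m) → (∀ w → Anc (par p) w v → m ≤ lbl w) → β p v ≡ m
  β-unique v m (w , a , e) low with β-attained v
  ... | u , b , e' = ℕP.≤-antisym (ℕP.≤-trans (β-lower a) (ℕP.≤-reflexive e))
                                  (ℕP.≤-trans (low u b) (ℕP.≤-reflexive e'))

  -- The vertex whose label is the common value of `β` lies below both siblings, so one of them is
  -- an ancestor of the other. For distinct siblings this closes a cycle through their parent.
  β-sibling-injective : IsTree p → ∀ {a b} → a ≢ zero → b ≢ zero → par p a ≡ par p b → β p a ≡ β p b → a ≡ b
  β-sibling-injective t {a} {b} a≢0 b≢0 e eβ with β-attained a | β-attained b
  ... | w , wa , ew | u , ub , eu with lbl-injective {v = w} {u} (trans ew (trans eβ (sym eu)))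
  ... | refl with Anc-comparable wa ub
  ... | inj₁ here = refl
  ... | inj₁ (up x) = ⊥-elim (b≢0 (acyclic t (subst (λ z → Anc (par p) z b) e x)))
  ... | inj₂ here = refl
  ... | inj₂ (up x) = ⊥-elim (a≢0 (acyclic t (subst (λ z → Anc (par p) z a) (sym e) x)))

  -- Removes the special case of the root: there `par` is the root again, with label 1, and `β` is
  -- never below 1.
  improperChild-β : ∀ v → improperChild p v ≡ (β p v <ᵇ lbl (par p v))
  improperChild-β (suc i) = refl
  improperChild-β zero with β-attained zero
  ... | w , _ , e = sym (<ᵇ-false {β p zero} (subst (1 ≤_) e (s≤s z≤n)))

  improper⇒< : ∀ v → improperChild p v ≡ true → β p v < lbl (par p v)
  improper⇒< v e = <ᵇ-sound _ _ (trans (sym (improperChild-β v)) e)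

  <⇒improper : ∀ v → β p v < lbl (par p v) → improperChild p v ≡ true
  <⇒improper v h = trans (improperChild-β v) (<ᵇ-true h)

  improper⇒≢0 : ∀ v → improperChild p v ≡ true → v ≢ zero
  improper⇒≢0 (suc v) e ()

  -- Repeats the decision made inside `impp`, so that `isImproperParent` is definitionally the
  -- predicate counted there.
  improperParent? : ∀ v → Dec (∃ λ j → improperChild p j ∧ does (par p j FinP.≟ v) ≡ true)
  improperParent? v = any? (λ j → (improperChild p j ∧ does (par p j FinP.≟ v)) Bool.≟ true)

  isImproperParent : V n → Bool
  isImproperParent v = does (improperParent? v)

  improperParent⇒ : ∀ v → isImproperParent v ≡ true → ∃ λ j → improperChild p j ≡ true × par p j ≡ v
  improperParent⇒ v e with does-true (improperParent? v) e
  ... | j , e' with ∧-true {improperChild p j} e'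
  ... | x , y = j , x , does-true (par p j FinP.≟ v) y

  ⇒improperParent : ∀ {v} j → improperChild p j ≡ true → par p j ≡ v → isImproperParent v ≡ true
  ⇒improperParent {v} j e e' = dec-true (improperParent? v) (j , cong₂ _∧_ e (dec-true (par p j FinP.≟ v) e'))

  isRootChild : V n → Bool
  isRootChild zero = false
  isRootChild (suc i) = does (p i FinP.≟ zero)

  -- GP v x a: a is reached from x by climbing through vertices with label ≥ λ(v);
  -- for x = v, a is on the greater ancestors path of v.
  data GP (v : V n) : V n → V n → Set where
    here : ∀ {x} → GP v x x
    up   : ∀ {x a} → lbl v ≤ lbl (par p x) → GP v (par p x) a → GP v x a

  GP-snoc : ∀ {v x a} → GP v x a → lbl v ≤ lbl (par p a) → GP v x (par p a)
  GP-snoc here h = up h here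
  GP-snoc (up k g) h = up k (GP-snoc g h)

  top-GP : ∀ f v x → GP v x (top p f v x)
  top-GP zero v x = here
  top-GP (suc f) v zero = here
  top-GP (suc f) v (suc w) with lbl v ≤ᵇ lbl (p w) in e
  ... | true  = up (does-true (lbl v ℕP.≤? lbl (p w)) e) (top-GP f v (p w))
  ... | false = here

  GP⇒Anc : ∀ {v x a} → GP v x a → Anc (par p) x a
  GP⇒Anc here = here
  GP⇒Anc (up _ g) = up (GP⇒Anc g)

  -- `top` stops only where a climb is forbidden, at the root, or when its fuel is spent; the
  -- hypothesis makes the fuel reach the root, so any other admissible climb ends below `top`.
  GP⇒Anc-top : ∀ f {v x a} → iter (par p) f x ≡ zero → GP v x a → Anc (par p) a (top p f v x)
  GP⇒Anc-top zero refl here = here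
  GP⇒Anc-top zero refl (up h g) = GP⇒Anc-top zero refl g
  GP⇒Anc-top (suc f) {v} {x} e here = GP⇒Anc (top-GP (suc f) v x)
  GP⇒Anc-top (suc f) {x = zero} e (up h g) = GP⇒Anc-top (suc f) refl' g
    where refl' = iter-fixed (par p) refl (suc f)
  GP⇒Anc-top (suc f) {v} {suc w} e (up h g) rewrite dec-true (lbl v ℕP.≤? lbl (p w)) h =
    GP⇒Anc-top f (trans (iter-comm (par p) f (suc w)) e) g

  -- `β` does not increase towards the root, so its value at `top` bounds it along the whole path.
  -- Together with `⇒leading` this replaces the computed `top` by a condition on `GP`, which can be
  -- transported between trees.
  leading⇒ : IsTree p → ∀ v → leading p v ≡ true → ∀ {a} → GP v v a → lbl v ≤ β p a
  leading⇒ t v e g = ℕP.≤-trans (ℕP.≤-reflexive (sym (does-true (β p (top p n v v) ℕP.≟ lbl v) e)))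
                                (β-anti (GP⇒Anc-top n (t v) g))

  ⇒leading : ∀ v → (∀ {a} → GP v v a → lbl v ≤ β p a) → leading p v ≡ true
  ⇒leading v h = dec-true (β p (top p n v v) ℕP.≟ lbl v)
    (ℕP.≤-antisym (β-lower (GP⇒Anc (top-GP n v v))) (h (top-GP n v v)))

-- Counting vertices with a boolean property

ind : Bool → ℕ
ind b = if b then 1 else 0

cnt : ∀ {m} → (Fin m → Bool) → ℕ
cnt P = sum (λ v → ind (P v))

length-filter-tabulate : ∀ {m} (P : A → Bool) (g : Fin m → A) →
  length (filter (λ v → P v Bool.≟ true) (tabulate g)) ≡ cnt (P ∘ g)
length-filter-tabulate {m = zero} P g = refl
length-filter-tabulate {m = suc m} P g with P (g zero)
... | true  = cong suc (length-filter-tabulate P (g ∘ suc))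
... | false = length-filter-tabulate P (g ∘ suc)

count≡cnt : ∀ {n} (p : Parents n) P → count p P ≡ cnt P
count≡cnt p P = length-filter-tabulate P id

cnt-cong : ∀ {m} {P Q : Fin m → Bool} → (∀ v → P v ≡ Q v) → cnt P ≡ cnt Q
cnt-cong h = sum-cong-≗ (λ v → cong ind (h v))

cnt-last : ∀ {m} (P : Fin (suc m) → Bool) → cnt P ≡ cnt (P ∘ inject₁) ℕ.+ ind (P (fromℕ m))
cnt-last P = sum-init-last (λ v → ind (P v))

-- Both sides add the other predicate's term at `i`, which expresses the difference of the counts
-- without subtraction.
cnt-change : ∀ {m} (P Q : Fin m → Bool) i → (∀ v → v ≢ i → P v ≡ Q v) → cnt P ℕ.+ ind (Q i) ≡ cnt Q ℕ.+ ind (P i)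
cnt-change {suc m} P Q i h = begin
  cnt P ℕ.+ ind (Q i)                                  ≡⟨ cong (ℕ._+ ind (Q i)) (sum-remove {i = i} (λ v → ind (P v))) ⟩
  ind (P i) ℕ.+ cnt (P ∘ punchIn i) ℕ.+ ind (Q i)      ≡⟨ cong (λ c → ind (P i) ℕ.+ c ℕ.+ ind (Q i)) (cnt-cong (λ j → h (punchIn i j) (FinP.punchInᵢ≢i i j))) ⟩
  ind (P i) ℕ.+ cnt (Q ∘ punchIn i) ℕ.+ ind (Q i)      ≡⟨ swap (ind (P i)) (cnt (Q ∘ punchIn i)) (ind (Q i)) ⟩
  ind (Q i) ℕ.+ cnt (Q ∘ punchIn i) ℕ.+ ind (P i)      ≡⟨ cong (ℕ._+ ind (P i)) (sym (sum-remove {i = i} (λ v → ind (Q v)))) ⟩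
  cnt Q ℕ.+ ind (P i)                                  ∎
  where
  open ≡-Reasoning
  swap : ∀ a b c → a ℕ.+ b ℕ.+ c ≡ c ℕ.+ b ℕ.+ a
  swap = ℕSolver.solve-∀

impe-cnt : ∀ {n} (p : Parents n) → impe p ≡ cnt (improperChild p)
impe-cnt p = count≡cnt p (improperChild p)

impp-cnt : ∀ {n} (p : Parents n) → impp p ≡ cnt (isImproperParent p)
impp-cnt p = count≡cnt p (isImproperParent p)

deg1-cnt : ∀ {n} (p : Parents n) → deg1 p ≡ cnt (isRootChild p)
-- The predicate inside `deg1` is an anonymous case split that agrees with `isRootChild` only
-- constructor by constructor. On both sides the term at `zero` vanishes by computation, and only
-- the successors are left.
deg1-cnt {n} p = length-filter-tabulate {A = V n} {m = n} _ Fin.suc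

lead-cnt : ∀ {n} (p : Parents n) → lead p ≡ cnt (leading p)
lead-cnt p = count≡cnt p (leading p)

-- Invariance of the statistics under pointwise equality of parent maps

module Ext {n} (p q : Parents n) (h : ∀ k → p k ≡ q k) where

  par≗ : ∀ v → par p v ≡ par q v
  par≗ zero = refl
  par≗ (suc k) = h k

  Anc→ : ∀ {w v} → Anc (par p) w v → Anc (par q) w v
  Anc→ = Anc-cong par≗

  Anc← : ∀ {w v} → Anc (par q) w v → Anc (par p) w v
  Anc← = Anc-cong (λ v → sym (par≗ v))

  IsTree→ : IsTree p → IsTree q
  IsTree→ t = reaches⇒IsTree q (λ v → Anc→ (IsTree⇒reaches p t v))

  β≗ : ∀ v → β p v ≡ β q v
  β≗ v with β-attained q v
  ... | w , a , e = β-unique p v _ (w , Anc← a , e) (λ u b → β-lower q (Anc→ b))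

  improper≗ : ∀ v → improperChild p v ≡ improperChild q v
  improper≗ v = trans (improperChild-β p v) (trans (cong₂ _<ᵇ_ (β≗ v) (cong lbl (par≗ v))) (sym (improperChild-β q v)))

  improperParent≗ : ∀ v → isImproperParent p v ≡ isImproperParent q v
  improperParent≗ v = bool-ext
    (λ e → let (j , x , y) = improperParent⇒ p v e in ⇒improperParent q j (trans (sym (improper≗ j)) x) (trans (sym (par≗ j)) y))
    (λ e → let (j , x , y) = improperParent⇒ q v e in ⇒improperParent p j (trans (improper≗ j) x) (trans (par≗ j) y))

  rootChild≗ : ∀ v → isRootChild p v ≡ isRootChild q v
  rootChild≗ zero = refl
  rootChild≗ (suc k) = cong (λ x → does (x FinP.≟ zero)) (h k)

  top≗ : ∀ f i v → top p f i v ≡ top q f i v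
  top≗ zero i v = refl
  top≗ (suc f) i zero = refl
  top≗ (suc f) i (suc w) rewrite h w | top≗ f i (q w) = refl

  leading≗ : ∀ v → leading p v ≡ leading q v
  leading≗ v = cong (λ b → does (b ℕP.≟ lbl v)) (trans (β≗ (top p n v v)) (cong (β q) (top≗ n v v)))

  impe≗ : impe p ≡ impe q
  impe≗ = trans (impe-cnt p) (trans (cnt-cong improper≗) (sym (impe-cnt q)))

  impp≗ : impp p ≡ impp q
  impp≗ = trans (impp-cnt p) (trans (cnt-cong improperParent≗) (sym (impp-cnt q)))

  deg1≗ : deg1 p ≡ deg1 q
  deg1≗ = trans (deg1-cnt p) (trans (cnt-cong rootChild≗) (sym (deg1-cnt q)))

  lead≗ : lead p ≡ lead q
  lead≗ = trans (lead-cnt p) (trans (cnt-cong leading≗) (sym (lead-cnt q)))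

lbl-inject₁ : ∀ {m} (v : Fin m) → lbl (inject₁ v) ≡ lbl v
lbl-inject₁ v = cong suc (FinP.toℕ-inject₁ v)

lbl<lbl-last : ∀ {m} (v : Fin m) → lbl v < lbl (fromℕ m)
lbl<lbl-last {m} v = s≤s (ℕP.≤-trans (FinP.toℕ<n v) (ℕP.≤-reflexive (sym (FinP.toℕ-fromℕ m))))

isRootChild-≡ : ∀ {n m} (p : Parents n) (q : Parents m) v w → (v ≡ zero → w ≡ zero) → (w ≡ zero → v ≡ zero) →
  (par p v ≡ zero → par q w ≡ zero) → (par q w ≡ zero → par p v ≡ zero) → isRootChild p v ≡ isRootChild q w
isRootChild-≡ p q zero zero _ _ _ _ = refl
isRootChild-≡ p q zero (suc w) f _ _ _ = ⊥-elim (FinP.0≢1+n (sym (f refl)))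
isRootChild-≡ p q (suc v) zero _ f _ _ = ⊥-elim (FinP.0≢1+n (sym (f refl)))
isRootChild-≡ p q (suc v) (suc w) _ _ f g = bool-ext
  (λ e → dec-true (q w FinP.≟ zero) (f (does-true (p v FinP.≟ zero) e)))
  (λ e → dec-true (p v FinP.≟ zero) (g (does-true (q w FinP.≟ zero) e)))

-- A new leaf with the largest label

-- Equations on `par` instead of a construction, so that the lemmas serve both for a leaf that has
-- just been added and for one found in a given tree.
record Leaf {n} (p : Parents n) (p' : Parents (suc n)) (v : V n) : Set where
  field
    par-last : par p' (fromℕ (suc n)) ≡ inject₁ v
    par-old  : ∀ w → par p' (inject₁ w) ≡ inject₁ (par p w)

module LeafProps {n} {p : Parents n} {p' : Parents (suc n)} {v : V n} (L : Leaf p p' v) where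
  open Leaf L

  N : V (suc n)
  N = fromℕ (suc n)

  Anc→ : ∀ {w u} → Anc (par p) w u → Anc (par p') (inject₁ w) (inject₁ u)
  Anc→ here = here
  Anc→ {w} {u} (up a) = up (subst (λ x → Anc (par p') x (inject₁ u)) (sym (par-old w)) (Anc→ a))

  Anc← : ∀ {x y} → Anc (par p') x y → ∀ w → x ≡ inject₁ w → ∃ λ u → y ≡ inject₁ u × Anc (par p) w u
  Anc← here w e = w , e , here
  Anc← (up a) w refl with Anc← a (par p w) (par-old w)
  ... | u , e , b = u , e , up b

  tree→ : IsTree p → IsTree p'
  tree→ t = reaches⇒IsTree p' go
    where
    go : ∀ x → Anc (par p') x zero
    go x with view x
    ... | ‵fromℕ = up (subst (λ x → Anc (par p') x zero) (sym par-last) (Anc→ (IsTree⇒reaches p t v)))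
    ... | ‵inject₁ w = Anc→ (IsTree⇒reaches p t w)

  tree← : IsTree p' → IsTree p
  tree← t = reaches⇒IsTree p go
    where
    go : ∀ w → Anc (par p) w zero
    go w with Anc← (IsTree⇒reaches p' t (inject₁ w)) w refl
    ... | zero , e , a = a

  β-old : ∀ u → β p' (inject₁ u) ≡ β p u
  β-old u with β-attained p u
  ... | w , a , e = β-unique p' (inject₁ u) _ (inject₁ w , Anc→ a , trans (lbl-inject₁ w) e) low
    where
    low : ∀ x → Anc (par p') x (inject₁ u) → β p u ≤ lbl x
    low x b with view x
    ... | ‵fromℕ = ℕP.≤-trans (β-lower p {u} here) (ℕP.<⇒≤ (lbl<lbl-last u))
    ... | ‵inject₁ w' with Anc← b w' refl
    ... | u' , e' , c rewrite inject₁-injective e' = ℕP.≤-trans (β-lower p c) (ℕP.≤-reflexive (sym (lbl-inject₁ w')))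

  β-last : β p' N ≡ lbl N
  β-last = β-unique p' N (lbl N) (N , here , refl) low
    where
    low : ∀ x → Anc (par p') x N → lbl N ≤ lbl x
    low x b with view x
    ... | ‵fromℕ = ℕP.≤-refl
    ... | ‵inject₁ w with Anc← b w refl
    ... | u , e , _ = ⊥-elim (fromℕ≢inject₁ e)

  improper-old : ∀ u → improperChild p' (inject₁ u) ≡ improperChild p u
  improper-old u = trans (improperChild-β p' (inject₁ u)) (trans (cong₂ _<ᵇ_ (β-old u)
    (trans (cong lbl (par-old u)) (lbl-inject₁ (par p u)))) (sym (improperChild-β p u)))

  improper-last : improperChild p' N ≡ false
  improper-last = trans (improperChild-β p' N) (<ᵇ-false {β p' N}
    (ℕP.≤-trans (ℕP.≤-reflexive (trans (cong lbl par-last) (lbl-inject₁ v)))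
      (ℕP.≤-trans (ℕP.<⇒≤ (lbl<lbl-last v)) (ℕP.≤-reflexive (sym β-last)))))

  improperParent⇒old : ∀ {x} → isImproperParent p' x ≡ true → ∃ λ j → improperChild p j ≡ true × x ≡ inject₁ (par p j)
  improperParent⇒old {x} e with improperParent⇒ p' x e
  ... | j' , a , b with view j'
  ... | ‵fromℕ with () ← trans (sym improper-last) a
  ... | ‵inject₁ j = j , trans (sym (improper-old j)) a , trans (sym b) (par-old j)

  improperParent-old : ∀ u → isImproperParent p' (inject₁ u) ≡ isImproperParent p u
  improperParent-old u = bool-ext
    (λ e → let (j , a , b) = improperParent⇒old e in ⇒improperParent p j a (sym (inject₁-injective b)))
    (λ e → let (j , a , b) = improperParent⇒ p u e in
      ⇒improperParent p' (inject₁ j) (trans (improper-old j) a) (trans (par-old j) (cong inject₁ b)))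

  improperParent-last : isImproperParent p' N ≡ false
  improperParent-last = BoolP.¬-not (λ e → fromℕ≢inject₁ (proj₂ (proj₂ (improperParent⇒old e))))

  GP→ : ∀ {u x a} → GP p u x a → GP p' (inject₁ u) (inject₁ x) (inject₁ a)
  GP→ here = here
  GP→ {u} {x} {a} (up h g) = up
    (subst₂ _≤_ (sym (lbl-inject₁ u)) (sym (trans (cong lbl (par-old x)) (lbl-inject₁ (par p x)))) h)
    (subst (λ z → GP p' (inject₁ u) z (inject₁ a)) (sym (par-old x)) (GP→ g))

  GP← : ∀ {u y b} → GP p' (inject₁ u) y b → ∀ x → y ≡ inject₁ x → ∃ λ a → b ≡ inject₁ a × GP p u x a
  GP← here x e = x , e , here
  GP← {u} (up h g) x refl with GP← g (par p x) (par-old x)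
  ... | a , e , g' = a , e , up (subst₂ _≤_ (lbl-inject₁ u) (trans (cong lbl (par-old x)) (lbl-inject₁ (par p x))) h) g'

  leading-old : IsTree p → ∀ u → leading p' (inject₁ u) ≡ leading p u
  leading-old t u = bool-ext
    (λ e → ⇒leading p u (λ {a} g → subst₂ _≤_ (lbl-inject₁ u) (β-old a) (leading⇒ p' (tree→ t) (inject₁ u) e (GP→ g))))
    (λ e → ⇒leading p' (inject₁ u) (back e))
    where
    back : leading p u ≡ true → ∀ {b} → GP p' (inject₁ u) (inject₁ u) b → lbl (inject₁ u) ≤ β p' b
    back e g with GP← g u refl
    ... | a , refl , g' = subst₂ _≤_ (sym (lbl-inject₁ u)) (sym (β-old a)) (leading⇒ p t u e g')

  leading-last : leading p' N ≡ true
  leading-last = ⇒leading p' N go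
    where
    go : ∀ {b} → GP p' N N b → lbl N ≤ β p' b
    go here = ℕP.≤-reflexive (sym β-last)
    go (up h g) = ⊥-elim (ℕP.<⇒≱ (lbl<lbl-last v) (ℕP.≤-trans h (ℕP.≤-reflexive (trans (cong lbl par-last) (lbl-inject₁ v)))))

  rootChild-old : ∀ u → isRootChild p' (inject₁ u) ≡ isRootChild p u
  rootChild-old u = isRootChild-≡ p' p (inject₁ u) u inject₁-injective (cong inject₁)
    (λ e → inject₁-injective (trans (sym (par-old u)) e)) (λ e → trans (par-old u) (cong inject₁ e))

  rootChild-last : isRootChild p' N ≡ does (v FinP.≟ zero)
  rootChild-last = bool-ext
    (λ e → dec-true (v FinP.≟ zero) (inject₁-injective (trans (sym par-last) (does-true (par p' N FinP.≟ zero) e))))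
    (λ e → dec-true (par p' N FinP.≟ zero) (trans par-last (cong inject₁ (does-true (v FinP.≟ zero) e))))

  impe-leaf : impe p' ≡ impe p
  impe-leaf = trans (impe-cnt p') (trans (cnt-last (improperChild p')) (trans
    (cong₂ ℕ._+_ (cnt-cong improper-old) (cong ind improper-last)) (trans (ℕP.+-identityʳ _) (sym (impe-cnt p)))))

  impp-leaf : impp p' ≡ impp p
  impp-leaf = trans (impp-cnt p') (trans (cnt-last (isImproperParent p')) (trans
    (cong₂ ℕ._+_ (cnt-cong improperParent-old) (cong ind improperParent-last)) (trans (ℕP.+-identityʳ _) (sym (impp-cnt p)))))

  deg1-leaf : deg1 p' ≡ deg1 p ℕ.+ ind (does (v FinP.≟ zero))
  deg1-leaf = trans (deg1-cnt p') (trans (cnt-last (isRootChild p')) (cong₂ ℕ._+_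
    (trans (cnt-cong rootChild-old) (sym (deg1-cnt p))) (cong ind rootChild-last)))

  lead-leaf : IsTree p → lead p' ≡ suc (lead p)
  lead-leaf t = trans (lead-cnt p') (trans (cnt-last (leading p')) (trans (cong₂ ℕ._+_
    (trans (cnt-cong (leading-old t)) (sym (lead-cnt p))) (cong ind leading-last)) (ℕP.+-comm (lead p) 1)))

-- Inserting the largest label above a vertex

-- In p', the largest label N sits on the edge above i and has taken over some children of i.
data Step {n} (p : Parents n) (p' : Parents (suc n)) (i v : V n) : Set where
  at-i  : v ≡ i → par p' (inject₁ v) ≡ fromℕ (suc n) → Step p p' i v
  moved : v ≢ i → par p' (inject₁ v) ≡ fromℕ (suc n) → par p v ≡ i → Step p p' i v
  kept  : v ≢ i → par p' (inject₁ v) ≡ inject₁ (par p v) → Step p p' i v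

record Insertion {n} (p : Parents n) (p' : Parents (suc n)) (i : V n) : Set where
  field
    i≢0      : i ≢ zero
    par-last : par p' (fromℕ (suc n)) ≡ inject₁ (par p i)
    step     : ∀ v → Step p p' i v

  -- Used in two ways: it bounds `β` of every moved vertex by the label of `i`, and it makes `i`
  -- recognisable in `p'` alone.
  Dominant : Set
  Dominant = ∀ v → v ≢ i → par p' (inject₁ v) ≡ fromℕ (suc n) → β p' (inject₁ v) < β p' (inject₁ i)

module InsertionProps {n} {p : Parents n} {p' : Parents (suc n)} {i : V n} (E : Insertion p p' i) where
  open Insertion E

  N : V (suc n)
  N = fromℕ (suc n)

  par-i : par p' (inject₁ i) ≡ N
  par-i with step i
  ... | at-i _ e = e
  ... | moved ne _ _ = ⊥-elim (ne refl)
  ... | kept ne _ = ⊥-elim (ne refl)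

  leave-i : ∀ {x} → inject₁ i ≢ x → Anc (par p') (inject₁ i) x → Anc (par p') N x
  leave-i ne here = ⊥-elim (ne refl)
  leave-i {x} ne (up a) = subst (λ y → Anc (par p') y x) par-i a

  -- The subtree of `i` turns into the subtree of `N`, since moved children no longer lie below `i`.
  -- Hence `N` takes the place of `i` as an ancestor.
  Anc→ : ∀ {w v} → Anc (par p) w v → (v ≢ i → Anc (par p') (inject₁ w) (inject₁ v)) × (v ≡ i → Anc (par p') (inject₁ w) N)
  Anc→ here = (λ _ → here) , λ { refl → up (subst (λ y → Anc (par p') y N) (sym par-i) here) }
  Anc→ {w} {v} (up a) with Anc→ a | step w
  ... | f , g | kept _ e = (λ ne → up (subst (λ y → Anc (par p') y (inject₁ v)) (sym e) (f ne))) ,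
                           (λ eq → up (subst (λ y → Anc (par p') y N) (sym e) (g eq)))
  ... | f , g | at-i refl e =
    (λ ne → up (subst (λ y → Anc (par p') y (inject₁ v)) (sym e) (up (subst (λ y → Anc (par p') y (inject₁ v)) (sym par-last) (f ne))))) ,
    (λ eq → up (subst (λ y → Anc (par p') y N) (sym e) here))
  -- The old path runs through `i`, while `w` now hangs directly below `N`: the part from
  -- `inject₁ i` to `N` is cut off.
  ... | f , g | moved _ e r rewrite r =
    (λ ne → up (subst (λ y → Anc (par p') y (inject₁ v)) (sym e) (leave-i (λ q → ne (sym (inject₁-injective q))) (f ne)))) ,
    (λ eq → up (subst (λ y → Anc (par p') y N) (sym e) here))

  -- Mutual with `Anc←N`: a path of `p'` that enters `N` is read in `p` as standing at `i`, and
  -- continues from the parent of `i`.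
  Anc←  : ∀ {x y} → Anc (par p') x y → ∀ w → x ≡ inject₁ w → ∀ v → (y ≡ inject₁ v → Anc (par p) w v) × (y ≡ N → Anc (par p) w i)
  Anc←N : ∀ {x y} → Anc (par p') x y → x ≡ N → ∀ v → y ≡ inject₁ v → Anc (par p) i v
  Anc← here w refl v = (λ e → subst (Anc (par p) w) (inject₁-injective e) here) , (λ e → ⊥-elim (fromℕ≢inject₁ (sym e)))
  Anc← (up a) w refl v with step w
  ... | at-i refl q = (λ e → Anc←N a q v e) , (λ _ → here)
  ... | moved _ q refl = (λ e → up (Anc←N a q v e)) , (λ _ → up here)
  ... | kept _ q = (λ e → up (proj₁ (Anc← a (par p w) q v) e)) , (λ e → up (proj₂ (Anc← a (par p w) q v) e))
  Anc←N here refl v e = ⊥-elim (fromℕ≢inject₁ e)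
  Anc←N (up a) refl v e = up (proj₁ (Anc← a (par p i) par-last v) e)

  tree→ : IsTree p → IsTree p'
  tree→ t = reaches⇒IsTree p' go
    where
    old : ∀ w → Anc (par p') (inject₁ w) zero
    old w = proj₁ (Anc→ (IsTree⇒reaches p t w)) (λ e → i≢0 (sym e))
    go : ∀ x → Anc (par p') x zero
    go x with view x
    ... | ‵fromℕ = up (subst (λ x → Anc (par p') x zero) (sym par-last) (old (par p i)))
    ... | ‵inject₁ w = old w

  tree← : IsTree p' → IsTree p
  tree← t = reaches⇒IsTree p (λ w → proj₁ (Anc← (IsTree⇒reaches p' t (inject₁ w)) w refl zero) refl)

  -- Away from `i` the old descendants are unchanged, and `N`, having the largest label, never
  -- lowers the minimum.
  β-old : ∀ v → v ≢ i → β p' (inject₁ v) ≡ β p v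
  β-old v ne with β-attained p v
  ... | w , a , e = β-unique p' (inject₁ v) _ (inject₁ w , proj₁ (Anc→ a) ne , trans (lbl-inject₁ w) e) low
    where
    low : ∀ x → Anc (par p') x (inject₁ v) → β p v ≤ lbl x
    low x b with view x
    ... | ‵fromℕ = ℕP.≤-trans (β-lower p {v} here) (ℕP.<⇒≤ (lbl<lbl-last v))
    ... | ‵inject₁ w' = ℕP.≤-trans (β-lower p (proj₁ (Anc← b w' refl v) refl)) (ℕP.≤-reflexive (sym (lbl-inject₁ w')))

  β-last : β p' N ≡ β p i
  β-last with β-attained p i
  ... | w , a , e = β-unique p' N _ (inject₁ w , proj₂ (Anc→ a) refl , trans (lbl-inject₁ w) e) low
    where
    low : ∀ x → Anc (par p') x N → β p i ≤ lbl x
    low x b with view x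
    ... | ‵fromℕ = ℕP.≤-trans (β-lower p {i} here) (ℕP.<⇒≤ (lbl<lbl-last i))
    ... | ‵inject₁ w' = ℕP.≤-trans (β-lower p (proj₂ (Anc← b w' refl i) refl)) (ℕP.≤-reflexive (sym (lbl-inject₁ w')))

  β-i : β p i ≤ β p' (inject₁ i)
  β-i = ℕP.≤-trans (ℕP.≤-reflexive (sym β-last)) (β-anti p' {inject₁ i} {N} (up (subst (λ y → Anc (par p') y N) (sym par-i) here)))

  par-kept : ∀ {v} → par p v ≢ i → v ≢ i → par p' (inject₁ v) ≡ inject₁ (par p v)
  par-kept {v} ne ne' with step v
  ... | at-i e _ = ⊥-elim (ne' e)
  ... | moved _ _ e = ⊥-elim (ne e)
  ... | kept _ e = e

  module Stats (t : IsTree p) (dom : Dominant) where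

    par-i≢i : par p i ≢ i
    par-i≢i e = i≢0 (acyclic p t (subst (λ y → Anc (par p) y i) (sym e) here))

    -- Dominance puts `β` of a moved vertex below `β` of what remains under `i`, and that is at most
    -- the label of `i`. So a moved vertex was an improper child of `i`.
    β-moved : ∀ {v} → v ≢ i → par p' (inject₁ v) ≡ N → β p v < lbl i
    β-moved {v} ne e = subst₂ _<_ (β-old v ne) (lbl-inject₁ i) (ℕP.<-≤-trans (dom v ne e) (β-lower p' {inject₁ i} here))

    improper-i : improperChild p' (inject₁ i) ≡ true
    improper-i = <⇒improper p' (inject₁ i) (ℕP.≤-<-trans (β-lower p' {inject₁ i} here)
      (subst₂ _<_ (sym (lbl-inject₁ i)) (cong lbl (sym par-i)) (lbl<lbl-last i)))

    improper-last : improperChild p' N ≡ improperChild p i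
    improper-last = trans (improperChild-β p' N) (trans (cong₂ _<ᵇ_ β-last
      (trans (cong lbl par-last) (lbl-inject₁ (par p i)))) (sym (improperChild-β p i)))

    -- A moved edge is improper on both sides: afterwards because its parent has the largest label,
    -- before by `β-moved`.
    improper-old : ∀ v → v ≢ i → improperChild p' (inject₁ v) ≡ improperChild p v
    improper-old v ne with step v
    ... | at-i e _ = ⊥-elim (ne e)
    ... | kept _ e = trans (improperChild-β p' (inject₁ v)) (trans (cong₂ _<ᵇ_ (β-old v ne)
            (trans (cong lbl e) (lbl-inject₁ (par p v)))) (sym (improperChild-β p v)))
    ... | moved _ e r = trans
      (<⇒improper p' (inject₁ v) (ℕP.≤-<-trans (β-lower p' {inject₁ v} here)
        (subst₂ _<_ (sym (lbl-inject₁ v)) (cong lbl (sym e)) (lbl<lbl-last v))))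
      (sym (<⇒improper p v (subst (λ y → β p v < lbl y) (sym r) (β-moved ne e))))

    improperParent-last : isImproperParent p' N ≡ true
    improperParent-last = ⇒improperParent p' (inject₁ i) improper-i par-i

    improperParent-old : ∀ v → v ≢ i → isImproperParent p' (inject₁ v) ≡ isImproperParent p v
    improperParent-old v ne = bool-ext to from
      where
      to : isImproperParent p' (inject₁ v) ≡ true → isImproperParent p v ≡ true
      to e with improperParent⇒ p' (inject₁ v) e
      ... | j' , a , b with view j'
      ... | ‵fromℕ = ⇒improperParent p i (trans (sym improper-last) a) (inject₁-injective (trans (sym par-last) b))
      ... | ‵inject₁ j with step j
      ...   | at-i _ q = ⊥-elim (fromℕ≢inject₁ (trans (sym q) b))
      ...   | moved _ q _ = ⊥-elim (fromℕ≢inject₁ (trans (sym q) b))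
      ...   | kept ne' q = ⇒improperParent p j (trans (sym (improper-old j ne')) a) (inject₁-injective (trans (sym q) b))
      from : isImproperParent p v ≡ true → isImproperParent p' (inject₁ v) ≡ true
      from e with improperParent⇒ p v e
      ... | j , a , refl with j FinP.≟ i
      ... | yes refl = ⇒improperParent p' N (trans improper-last a) par-last
      ... | no ne' = ⇒improperParent p' (inject₁ j) (trans (improper-old j ne') a) (par-kept ne ne')

    improperParent-i⇒ : isImproperParent p' (inject₁ i) ≡ true →
      ∃ λ j → improperChild p j ≡ true × par p j ≡ i × par p' (inject₁ j) ≢ N
    improperParent-i⇒ e with improperParent⇒ p' (inject₁ i) e
    ... | j' , a , b with view j'
    ... | ‵fromℕ = ⊥-elim (par-i≢i (inject₁-injective (trans (sym par-last) b)))
    ... | ‵inject₁ j with step j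
    ...   | at-i _ q = ⊥-elim (fromℕ≢inject₁ (trans (sym q) b))
    ...   | moved _ q _ = ⊥-elim (fromℕ≢inject₁ (trans (sym q) b))
    ...   | kept ne q = j , trans (sym (improper-old j ne)) a , inject₁-injective (trans (sym q) b) ,
                        (λ e' → fromℕ≢inject₁ (trans (sym e') b))

    ⇒improperParent-i : ∀ j → improperChild p j ≡ true → par p j ≡ i → par p' (inject₁ j) ≢ N →
      isImproperParent p' (inject₁ i) ≡ true
    ⇒improperParent-i j a b c with step j
    ... | at-i _ q = ⊥-elim (c q)
    ... | moved _ q _ = ⊥-elim (c q)
    ... | kept ne q = ⇒improperParent p' (inject₁ j) (trans (improper-old j ne) a) (trans q (cong inject₁ b))

    rootChild-i : isRootChild p' (inject₁ i) ≡ false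
    rootChild-i = lemma (inject₁ i) par-i
      where
      lemma : ∀ x → par p' x ≡ N → isRootChild p' x ≡ false
      lemma zero e = refl
      lemma (suc x) e = dec-false (p' x FinP.≟ zero) (λ e' → FinP.0≢1+n (trans (sym e') e))

    rootChild-last : isRootChild p' N ≡ isRootChild p i
    rootChild-last = isRootChild-≡ p' p N i (λ ()) (λ e → ⊥-elim (i≢0 e))
      (λ e → inject₁-injective (trans (sym par-last) e)) (λ e → trans par-last (cong inject₁ e))

    rootChild-old : ∀ v → v ≢ i → isRootChild p' (inject₁ v) ≡ isRootChild p v
    rootChild-old v ne = isRootChild-≡ p' p (inject₁ v) v inject₁-injective (cong inject₁) to from
      where
      to : par p' (inject₁ v) ≡ zero → par p v ≡ zero
      to e with step v
      ... | at-i _ q = ⊥-elim (FinP.0≢1+n (trans (sym e) q))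
      ... | moved _ q _ = ⊥-elim (FinP.0≢1+n (trans (sym e) q))
      ... | kept _ q = inject₁-injective (trans (sym q) e)
      from : par p v ≡ zero → par p' (inject₁ v) ≡ zero
      from e = trans (par-kept (λ e' → i≢0 (trans (sym e') e)) ne) (cong inject₁ e)

    lbl-≤→ : ∀ (v x : V n) → lbl v ≤ lbl x → lbl (inject₁ v) ≤ lbl (inject₁ x)
    lbl-≤→ v x = subst₂ _≤_ (sym (lbl-inject₁ v)) (sym (lbl-inject₁ x))

    lbl-≤← : ∀ (v x : V n) → lbl (inject₁ v) ≤ lbl (inject₁ x) → lbl v ≤ lbl x
    lbl-≤← v x = subst₂ _≤_ (lbl-inject₁ v) (lbl-inject₁ x)

    lbl-≤N : ∀ (v : V n) → lbl (inject₁ v) ≤ lbl N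
    lbl-≤N v = ℕP.≤-trans (ℕP.≤-reflexive (lbl-inject₁ v)) (ℕP.<⇒≤ (lbl<lbl-last v))

    -- A greater ancestors path of p' is one of p, with N standing for i; the only
    -- new climbs are from a moved child c to N when λ(v) > λ(i), and then
    -- β(c) < λ(i) < λ(v) already prevents v from leading.
    leading→ : ∀ v → (∀ {a} → GP p v v a → lbl v ≤ β p a) →
      ∀ {y b} → GP p' (inject₁ v) y b → (∃ λ x → y ≡ inject₁ x × GP p v v x) ⊎ (y ≡ N × GP p v v i) →
      lbl (inject₁ v) ≤ β p' b
    leading→ v H here (inj₁ (x , refl , g)) with x FinP.≟ i
    ... | yes refl = subst (_≤ β p' (inject₁ i)) (sym (lbl-inject₁ v)) (ℕP.≤-trans (H g) β-i)
    ... | no ne = subst₂ _≤_ (sym (lbl-inject₁ v)) (sym (β-old x ne)) (H g)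
    leading→ v H here (inj₂ (refl , g)) = subst₂ _≤_ (sym (lbl-inject₁ v)) (sym β-last) (H g)
    leading→ v H (up h k) (inj₂ (refl , g)) = leading→ v H k (inj₁ (par p i , par-last ,
      GP-snoc p g (lbl-≤← v (par p i) (subst (λ y → lbl (inject₁ v) ≤ lbl y) par-last h))))
    leading→ v H (up h k) (inj₁ (x , refl , g)) with step x
    ... | at-i refl q = leading→ v H k (inj₂ (q , g))
    ... | kept _ q = leading→ v H k (inj₁ (par p x , q ,
            GP-snoc p g (lbl-≤← v (par p x) (subst (λ y → lbl (inject₁ v) ≤ lbl y) q h))))
    ... | moved ne q refl = leading→ v H k (inj₂ (q , GP-snoc p g (ℕP.≤-trans (H g) (ℕP.<⇒≤ (β-moved ne q)))))

    leading← : ∀ v → (∀ {b} → GP p' (inject₁ v) (inject₁ v) b → lbl (inject₁ v) ≤ β p' b) →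
      ∀ {x a} → GP p v x a → (x ≢ i → GP p' (inject₁ v) (inject₁ v) (inject₁ x)) → (x ≡ i → GP p' (inject₁ v) (inject₁ v) N) →
      lbl v ≤ β p a
    leading← v H {x} here f g with x FinP.≟ i
    ... | yes refl = subst₂ _≤_ (lbl-inject₁ v) β-last (H (g refl))
    ... | no ne = subst₂ _≤_ (lbl-inject₁ v) (β-old x ne) (H (f ne))
    leading← v H {x} (up h k) f g = leading← v H k f' g'
      where
      climb : ∀ {x y} → GP p' (inject₁ v) (inject₁ v) x → par p' x ≡ y → lbl (inject₁ v) ≤ lbl y → GP p' (inject₁ v) (inject₁ v) y
      climb g refl h = GP-snoc p' g h
      f' : par p x ≢ i → GP p' (inject₁ v) (inject₁ v) (inject₁ (par p x))
      f' ne with x FinP.≟ i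
      ... | yes refl = climb (g refl) par-last (lbl-≤→ v (par p i) h)
      ... | no ne' = climb (f ne') (par-kept ne ne') (lbl-≤→ v (par p x) h)
      g' : par p x ≡ i → GP p' (inject₁ v) (inject₁ v) N
      g' e with step x
      ... | at-i e' q = g e'
      ... | moved ne q _ = climb (f ne) q (lbl-≤N v)
      ... | kept ne q = climb (climb (f ne) q (lbl-≤→ v (par p x) h)) (trans (cong (par p' ∘ inject₁) e) par-i) (lbl-≤N v)

    leading-old : ∀ v → leading p' (inject₁ v) ≡ leading p v
    leading-old v = bool-ext
      (λ e → ⇒leading p v (λ g → leading← v (leading⇒ p' (tree→ t) (inject₁ v) e) g (λ _ → here)
        (λ { refl → up (subst (λ y → lbl (inject₁ i) ≤ lbl y) (sym par-i) (lbl-≤N i))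
                       (subst (λ y → GP p' (inject₁ i) y N) (sym par-i) here) })))
      (λ e → ⇒leading p' (inject₁ v) (λ g → leading→ v (leading⇒ p t v e) g (inj₁ (v , refl , here))))

    leading-last : leading p' N ≡ false
    leading-last = BoolP.¬-not (λ e → ℕP.<⇒≱ (lbl<lbl-last i)
      (ℕP.≤-trans (leading⇒ p' (tree→ t) N e here) (ℕP.≤-trans (ℕP.≤-reflexive β-last) (β-lower p {i} here))))

    -- The edge above `N` inherits the status of the old edge above `i`, and the new edge from `N`
    -- to `i` is improper. The inherited indicator is added to both sides and cancelled.
    impe-insert : impe p' ≡ suc (impe p)
    impe-insert = ℕP.+-cancelʳ-≡ (ind (improperChild p i)) (impe p') (suc (impe p)) (begin
      impe p' ℕ.+ ind (improperChild p i)
        ≡⟨ cong (ℕ._+ ind (improperChild p i)) (trans (impe-cnt p') (cnt-last (improperChild p'))) ⟩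
      cnt (improperChild p' ∘ inject₁) ℕ.+ ind (improperChild p' N) ℕ.+ ind (improperChild p i)
        ≡⟨ cong (λ b → cnt (improperChild p' ∘ inject₁) ℕ.+ ind b ℕ.+ ind (improperChild p i)) improper-last ⟩
      cnt (improperChild p' ∘ inject₁) ℕ.+ ind (improperChild p i) ℕ.+ ind (improperChild p i)
        ≡⟨ cong (ℕ._+ ind (improperChild p i)) (cnt-change (improperChild p' ∘ inject₁) (improperChild p) i improper-old) ⟩
      cnt (improperChild p) ℕ.+ ind (improperChild p' (inject₁ i)) ℕ.+ ind (improperChild p i)
        ≡⟨ cong₂ (λ c b → c ℕ.+ ind b ℕ.+ ind (improperChild p i)) (sym (impe-cnt p)) improper-i ⟩
      impe p ℕ.+ 1 ℕ.+ ind (improperChild p i)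
        ≡⟨ cong (ℕ._+ ind (improperChild p i)) (ℕP.+-comm (impe p) 1) ⟩
      suc (impe p) ℕ.+ ind (improperChild p i) ∎)
      where open ≡-Reasoning

    -- `N` is an improper parent through its child `i`. Among the old vertices only `i` can change
    -- status; its two indicators are left for the individual moves to evaluate.
    impp-insert : impp p' ℕ.+ ind (isImproperParent p i) ≡ suc (impp p) ℕ.+ ind (isImproperParent p' (inject₁ i))
    impp-insert = begin
      impp p' ℕ.+ ind (isImproperParent p i)
        ≡⟨ cong (ℕ._+ ind (isImproperParent p i)) (trans (impp-cnt p') (cnt-last (isImproperParent p'))) ⟩
      C ℕ.+ ind (isImproperParent p' N) ℕ.+ ind (isImproperParent p i)
        ≡⟨ cong (λ b → C ℕ.+ ind b ℕ.+ ind (isImproperParent p i)) improperParent-last ⟩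
      C ℕ.+ 1 ℕ.+ ind (isImproperParent p i)
        ≡⟨ swap C (ind (isImproperParent p i)) ⟩
      suc (C ℕ.+ ind (isImproperParent p i))
        ≡⟨ cong suc (cnt-change (isImproperParent p' ∘ inject₁) (isImproperParent p) i improperParent-old) ⟩
      suc (cnt (isImproperParent p) ℕ.+ ind (isImproperParent p' (inject₁ i)))
        ≡⟨ cong (λ c → suc (c ℕ.+ ind (isImproperParent p' (inject₁ i)))) (sym (impp-cnt p)) ⟩
      suc (impp p) ℕ.+ ind (isImproperParent p' (inject₁ i)) ∎
      where
      open ≡-Reasoning
      C = cnt (isImproperParent p' ∘ inject₁)
      swap : ∀ c d → c ℕ.+ 1 ℕ.+ d ≡ suc (c ℕ.+ d)
      swap = ℕSolver.solve-∀

    deg1-insert : deg1 p' ≡ deg1 p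
    deg1-insert = begin
      deg1 p'
        ≡⟨ trans (deg1-cnt p') (cnt-last (isRootChild p')) ⟩
      cnt (isRootChild p' ∘ inject₁) ℕ.+ ind (isRootChild p' N)
        ≡⟨ cong (λ b → cnt (isRootChild p' ∘ inject₁) ℕ.+ ind b) rootChild-last ⟩
      cnt (isRootChild p' ∘ inject₁) ℕ.+ ind (isRootChild p i)
        ≡⟨ cnt-change (isRootChild p' ∘ inject₁) (isRootChild p) i rootChild-old ⟩
      cnt (isRootChild p) ℕ.+ ind (isRootChild p' (inject₁ i))
        ≡⟨ cong (λ b → cnt (isRootChild p) ℕ.+ ind b) rootChild-i ⟩
      cnt (isRootChild p) ℕ.+ 0
        ≡⟨ trans (ℕP.+-identityʳ _) (sym (deg1-cnt p)) ⟩
      deg1 p ∎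
      where open ≡-Reasoning

    lead-insert : lead p' ≡ lead p
    lead-insert = trans (lead-cnt p') (trans (cnt-last (leading p')) (trans
      (cong₂ ℕ._+_ (cnt-cong leading-old) (cong ind leading-last)) (trans (ℕP.+-identityʳ _) (sym (lead-cnt p)))))

-- The improper child with the largest β of each improper parent

argmax : ∀ {m} {P : Fin m → Set} (P? : ∀ v → Dec (P v)) (h : Fin m → ℕ) → ∃ P → ∃ λ j → P j × (∀ k → P k → h k ≤ h j)
argmax {suc m} {P} P? h (w , Pw) with any? (λ v → P? (suc v))
... | no none = zero , at-zero w Pw , bound
  where
  at-zero : ∀ w → P w → P zero
  at-zero zero x = x
  at-zero (suc w) x = ⊥-elim (none (w , x))
  bound : ∀ k → P k → h k ≤ h zero
  bound zero _ = ℕP.≤-refl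
  bound (suc k) x = ⊥-elim (none (k , x))
... | yes ex with argmax (λ v → P? (suc v)) (λ v → h (suc v)) ex | P? zero
... | j , Pj , b | no ¬P0 = suc j , Pj , λ { zero x → ⊥-elim (¬P0 x) ; (suc k) x → b k x }
... | j , Pj , b | yes P0 with ℕP.≤-total (h zero) (h (suc j))
... | inj₁ le = suc j , Pj , λ { zero x → le ; (suc k) x → b k x }
... | inj₂ ge = zero , P0 , λ { zero x → ℕP.≤-refl ; (suc k) x → ℕP.≤-trans (b k x) ge }

cnt-none : ∀ {m} (P : Fin m → Bool) → (∀ v → P v ≡ false) → cnt P ≡ 0
cnt-none {m} P h = trans (cnt-cong {P = P} {Q = λ _ → false} h) (sum-replicate-zero m)

cnt-unique : ∀ {m} (P : Fin m → Bool) j → P j ≡ true → (∀ k → P k ≡ true → k ≡ j) → cnt P ≡ 1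
cnt-unique {m} P j Pj u = begin
  cnt P                              ≡⟨ sym (ℕP.+-identityʳ _) ⟩
  cnt P ℕ.+ ind false                ≡⟨ cnt-change P (λ _ → false) j (λ k ne → BoolP.¬-not (λ e → ne (u k e))) ⟩
  cnt {m} (λ _ → false) ℕ.+ ind (P j) ≡⟨ cong₂ (λ c b → c ℕ.+ ind b) (cnt-none {m} (λ _ → false) (λ _ → refl)) Pj ⟩
  1                                  ∎
  where open ≡-Reasoning

cnt-fiber : ∀ {m l} (P : Fin m → Bool) (f : Fin m → Fin l) →
  sum (λ v → cnt (λ j → P j ∧ does (f j FinP.≟ v))) ≡ cnt P
cnt-fiber {l = l} P f = trans (∑-comm (λ v j → ind (P j ∧ does (f j FinP.≟ v)))) (sum-cong-≗ fiber)
  where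
  fiber : ∀ j → cnt (λ v → P j ∧ does (f j FinP.≟ v)) ≡ ind (P j)
  fiber j with P j
  ... | false = cnt-none {l} (λ _ → false) (λ _ → refl)
  ... | true = cnt-unique {l} (λ v → does (f j FinP.≟ v)) (f j) (dec-true (f j FinP.≟ f j) refl)
                 (λ v e → sym (does-true (f j FinP.≟ v) e))

module _ {n : ℕ} (p : Parents n) where

  larger? : ∀ j → Dec (∃ λ k → improperChild p k ≡ true × par p k ≡ par p j × β p j < β p k)
  larger? j = any? (λ k → (improperChild p k Bool.≟ true) ×-dec (par p k FinP.≟ par p j) ×-dec (β p j ℕP.<? β p k))

  hasLarger : V n → Bool
  hasLarger j = does (larger? j)

  isLargest : V n → Bool
  isLargest j = improperChild p j ∧ not (hasLarger j)

  isLargest⇒ : ∀ {j} → isLargest j ≡ true → improperChild p j ≡ true × (∀ k → improperChild p k ≡ true → par p k ≡ par p j → β p k ≤ β p j)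
  isLargest⇒ {j} e with ∧-true {improperChild p j} e
  ... | x , y = x , λ k a b → ℕP.≮⇒≥ (λ lt → false≢true (trans (sym (cong not (dec-true (larger? j) (k , a , b , lt)))) y))

  ⇒isLargest : ∀ {j} → improperChild p j ≡ true → (∀ k → improperChild p k ≡ true → par p k ≡ par p j → β p k ≤ β p j) → isLargest j ≡ true
  ⇒isLargest {j} x h = cong₂ _∧_ x (cong not (dec-false (larger? j) (λ { (k , a , b , lt) → ℕP.<⇒≱ lt (h k a b) })))

  -- Siblings have distinct `β`, so each improper parent has exactly one largest improper child; the
  -- count is taken over the fibres of `par p`.
  cnt-isLargest : IsTree p → cnt isLargest ≡ impp p
  cnt-isLargest t = trans (sym (cnt-fiber isLargest (par p))) (trans (sum-cong-≗ one) (sym (impp-cnt p)))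
    where
    one : ∀ v → cnt (λ j → isLargest j ∧ does (par p j FinP.≟ v)) ≡ ind (isImproperParent p v)
    one v with isImproperParent p v in eq
    ... | false = cnt-none (λ j → isLargest j ∧ does (par p j FinP.≟ v)) (λ j → BoolP.¬-not (no-child j))
      where
      no-child : ∀ j → isLargest j ∧ does (par p j FinP.≟ v) ≢ true
      no-child j e with ∧-true {isLargest j} e
      ... | x , y with () ← trans (sym eq) (⇒improperParent p j (proj₁ (isLargest⇒ x)) (does-true (par p j FinP.≟ v) y))
    ... | true with argmax (λ j → (improperChild p j Bool.≟ true) ×-dec (par p j FinP.≟ v)) (β p) (improperParent⇒ p v eq)
    ...   | j , (a , b) , h = cnt-unique (λ j → isLargest j ∧ does (par p j FinP.≟ v)) j
              (cong₂ _∧_ (⇒isLargest a (λ k x y → h k (x , trans y b))) (dec-true (par p j FinP.≟ v) b)) uniq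
      where
      uniq : ∀ k → isLargest k ∧ does (par p k FinP.≟ v) ≡ true → k ≡ j
      uniq k e with ∧-true {isLargest k} e
      ... | x , y with isLargest⇒ x | does-true (par p k FinP.≟ v) y
      ...   | x₁ , x₂ | y' = β-sibling-injective p t (improper⇒≢0 p k x₁) (improper⇒≢0 p j a) (trans y' (sym b))
                               (ℕP.≤-antisym (h k (x₁ , y')) (x₂ j a (trans b (sym y'))))

-- Codes and moves

-- Unlike functions, pointwise equal vectors are propositionally equal, as duplicate-freeness and
-- permutations of lists of trees require.
Code : ℕ → Set
Code n = Vec (V n) n

encode : ∀ {n} → (V n → V n) → Code n
encode g = Vec.tabulate (λ k → g (suc k))

par-encode : ∀ {n} (g : V n → V n) → g zero ≡ zero → ∀ v → par (lookup (encode g)) v ≡ g v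
par-encode g e zero = sym e
par-encode g e (suc k) = VecP.lookup∘tabulate (λ k → g (suc k)) k

code-ext : ∀ {n} {c d : Code n} → (∀ v → par (lookup c) v ≡ par (lookup d) v) → c ≡ d
code-ext {c = c} {d} h = trans (sym (VecP.tabulate∘lookup c)) (trans (VecP.tabulate-cong (λ k → h (suc k))) (VecP.tabulate∘lookup d))

extend : ∀ {n} → (V n → V (suc n)) → V (suc n) → V (suc n) → V (suc n)
extend f y x with view x
... | ‵fromℕ = y
... | ‵inject₁ v = f v

extend-last : ∀ {n} (f : V n → V (suc n)) y → extend f y (fromℕ (suc n)) ≡ y
extend-last {n} f y rewrite view-fromℕ (suc n) = refl

extend-old : ∀ {n} (f : V n → V (suc n)) y v → extend f y (inject₁ v) ≡ f v
extend-old f y v rewrite view-inject₁ v = refl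

addLeaf : ∀ {n} → Parents n → V n → Code (suc n)
addLeaf p v = encode (extend (λ w → inject₁ (par p w)) (inject₁ v))

insertAbove : ∀ {n} → Parents n → V n → (V n → Bool) → Code (suc n)
insertAbove {n} p i S = encode (extend
  (λ v → if does (v FinP.≟ i) ∨ S v then fromℕ (suc n) else inject₁ (par p v)) (inject₁ (par p i)))

initial : ∀ {n} → Parents n → V n → V n → Bool
initial p j v = improperChild p v ∧ (does (par p v FinP.≟ par p j) ∧ does (β p v ℕP.≤? β p j))

-- `above` takes a `Fin n`, so that `suc k` is never the root; `split` names the child bounding the
-- segment, and its parent is the vertex `i`.
data Move (n : ℕ) : Set where
  leaf  : V n → Move n
  above : Fin n → Move n
  split : V n → Move n

apply : ∀ {n} → Parents n → Move n → Code (suc n)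
apply p (leaf v)  = addLeaf p v
apply p (above k) = insertAbove p (suc k) (λ _ → false)
apply p (split j) = insertAbove p (par p j) (initial p j)

Valid : ∀ {n} → Parents n → Move n → Set
Valid p (leaf v)  = ⊤
Valid p (above k) = ⊤
Valid p (split j) = improperChild p j ≡ true

addLeaf-Leaf : ∀ {n} (p : Parents n) v → Leaf p (lookup (addLeaf p v)) v
addLeaf-Leaf {n} p v = record
  { par-last = trans (par-encode g refl (fromℕ (suc n))) (extend-last _ (inject₁ v))
  ; par-old = λ w → trans (par-encode g refl (inject₁ w)) (extend-old _ (inject₁ v) w) }
  where g = extend (λ w → inject₁ (par p w)) (inject₁ v)

module InsertAbove {n} (p : Parents n) (i : V n) (S : V n → Bool) (i≢0 : i ≢ zero)
  (S⇒ : ∀ v → S v ≡ true → v ≢ zero × par p v ≡ i) where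

  p' : Parents (suc n)
  p' = lookup (insertAbove p i S)

  private
    f : V n → V (suc n)
    f v = if does (v FinP.≟ i) ∨ S v then fromℕ (suc n) else inject₁ (par p v)

    f-zero : f zero ≡ zero
    f-zero rewrite dec-false (zero FinP.≟ i) (λ e → i≢0 (sym e)) with S zero in eq
    ... | true = ⊥-elim (proj₁ (S⇒ zero eq) refl)
    ... | false = refl

    par-f : ∀ v → par p' (inject₁ v) ≡ f v
    par-f v = trans (par-encode (extend f (inject₁ (par p i))) f-zero (inject₁ v)) (extend-old f _ v)

  moved⇒S : ∀ v → v ≢ i → par p' (inject₁ v) ≡ fromℕ (suc n) → S v ≡ true
  moved⇒S v ne e = go (trans (sym (par-f v)) e)
    where
    go : f v ≡ fromℕ (suc n) → S v ≡ true
    go e' rewrite dec-false (v FinP.≟ i) ne with S v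
    ... | true = refl
    ... | false = ⊥-elim (fromℕ≢inject₁ (sym e'))

  S⇒moved : ∀ v → S v ≡ true → par p' (inject₁ v) ≡ fromℕ (suc n)
  S⇒moved v e = trans (par-f v) (cong (λ b → if b then fromℕ (suc n) else inject₁ (par p v))
    (trans (cong (does (v FinP.≟ i) ∨_) e) (BoolP.∨-zeroʳ _)))

  insertion : Insertion p p' i
  insertion = record
    { i≢0 = i≢0
    ; par-last = trans (par-encode (extend f (inject₁ (par p i))) f-zero (fromℕ (suc n))) (extend-last f _)
    ; step = step }
    where
    step : ∀ v → Step p p' i v
    step v with v FinP.≟ i
    ... | yes e = at-i e (trans (par-f v) (cong (λ b → if b ∨ S v then fromℕ (suc n) else inject₁ (par p v)) (dec-true (v FinP.≟ i) e)))
    ... | no ne with S v in eq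
    ...   | true = moved ne (S⇒moved v eq) (proj₂ (S⇒ v eq))
    ...   | false = kept ne (trans (par-f v) (cong₂ (λ b c → if b ∨ c then fromℕ (suc n) else inject₁ (par p v)) (dec-false (v FinP.≟ i) ne) eq))

module Above {n} (p : Parents n) (k : Fin n) where
  open InsertAbove p (suc k) (λ _ → false) (λ ()) (λ _ ()) public

  dominant : Insertion.Dominant insertion
  dominant v ne e with () ← moved⇒S v ne e

Anc-last : ∀ {f : A → A} {x y} → Anc f x y → x ≡ y ⊎ (∃ λ c → Anc f x c × f c ≡ y)
Anc-last here = inj₁ refl
Anc-last {x = x} (up a) with Anc-last a
... | inj₁ e = inj₂ (x , here , e)
... | inj₂ (c , b , e) = inj₂ (c , up b , e)

module Split {n} (p : Parents n) (t : IsTree p) (j : V n) (imp : improperChild p j ≡ true) where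

  initial⇒ : ∀ v → initial p j v ≡ true → improperChild p v ≡ true × par p v ≡ par p j × β p v ≤ β p j
  initial⇒ v e with ∧-true {improperChild p v} e
  ... | a , e' with ∧-true {does (par p v FinP.≟ par p j)} e'
  ... | b , c = a , does-true (par p v FinP.≟ par p j) b , does-true (β p v ℕP.≤? β p j) c

  ⇒initial : ∀ v → improperChild p v ≡ true → par p v ≡ par p j → β p v ≤ β p j → initial p j v ≡ true
  ⇒initial v a b c = cong₂ _∧_ a (cong₂ _∧_ (dec-true (par p v FinP.≟ par p j) b) (dec-true (β p v ℕP.≤? β p j) c))

  -- No child of the root is improper: the root has label 1, the least possible value of `β`.
  par-j≢0 : par p j ≢ zero
  par-j≢0 e with β-attained p j | improper⇒< p j imp
  ... | w , _ , e' | lt rewrite e | sym e' with s≤s () ← lt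

  initial⇒child : ∀ v → initial p j v ≡ true → v ≢ zero × par p v ≡ par p j
  initial⇒child v e = let (a , b , _) = initial⇒ v e in improper⇒≢0 p v a , b

  open InsertAbove p (par p j) (initial p j) par-j≢0 initial⇒child public

  j≢par-j : j ≢ par p j
  j≢par-j e = improper⇒≢0 p j imp (acyclic p t (subst (λ y → Anc (par p) y j) e here))

  module I = InsertionProps insertion

  -- Three kinds of labels remain below `i`: its own, which exceeds `β p j` because `j` is improper;
  -- those below a proper child, which are at least the label of `i`; and those below an improper
  -- child outside the segment, whose `β` is larger by choice.
  β-remaining : ∀ {x} → Anc (par p') x (inject₁ (par p j)) → β p j < lbl x
  β-remaining {x} a with Anc-last a
  ... | inj₁ refl = subst (β p j <_) (sym (lbl-inject₁ (par p j))) (improper⇒< p j imp)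
  ... | inj₂ (c' , b , e) with view c'
  ... | ‵fromℕ = ⊥-elim (par-j≢0 (acyclic p t (subst (λ y → Anc (par p) y (par p j)) (sym loop) here)))
    where
    loop : par p (par p j) ≡ par p j
    loop = inject₁-injective (trans (sym (Insertion.par-last insertion)) e)
  ... | ‵inject₁ c with Insertion.step insertion c
  ...   | at-i _ q = ⊥-elim (fromℕ≢inject₁ (trans (sym q) e))
  ...   | moved _ q _ = ⊥-elim (fromℕ≢inject₁ (trans (sym q) e))
  ...   | kept ne q = ℕP.<-≤-trans lower (ℕP.≤-trans (ℕP.≤-reflexive (sym (I.β-old c ne))) (β-lower p' b))
    where
    par-c : par p c ≡ par p j
    par-c = inject₁-injective (trans (sym q) e)
    lower : β p j < β p c
    lower with improperChild p c in eq
    ... | false = ℕP.<-≤-trans (improper⇒< p j imp) (ℕP.≮⇒≥ (λ lt → false≢true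
                    (trans (sym eq) (<⇒improper p c (subst (λ y → β p c < lbl y) (sym par-c) lt)))))
    ... | true = ℕP.≰⇒> (λ le → fromℕ≢inject₁ (trans (sym (S⇒moved c (⇒initial c eq par-c le))) e))

  dominant : Insertion.Dominant insertion
  dominant v ne e = ℕP.≤-<-trans
    (ℕP.≤-trans (ℕP.≤-reflexive (I.β-old v ne)) (proj₂ (proj₂ (initial⇒ v (moved⇒S v ne e)))))
    (let (x , a , ex) = β-attained p' (inject₁ (par p j)) in subst (β p j <_) ex (β-remaining a))

  module St = I.Stats t dominant

  larger⇒kept : ∀ k → improperChild p k ≡ true → par p k ≡ par p j → β p j < β p k → par p' (inject₁ k) ≢ fromℕ (suc n)
  larger⇒kept k a b lt q = ℕP.<⇒≱ lt (proj₂ (proj₂ (initial⇒ k (moved⇒S k k≢ q))))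
    where
    k≢ : k ≢ par p j
    k≢ e = par-j≢0 (acyclic p t (subst (λ y → Anc (par p) y (par p j)) (sym (trans (cong (par p) (sym e)) b)) here))

  -- The improper children left to `i` are those beyond `j` in the order of `β`.
  improperParent-split : isImproperParent p' (inject₁ (par p j)) ≡ hasLarger p j
  improperParent-split = bool-ext
    (λ e → let (k , a , b , c) = St.improperParent-i⇒ e in
      dec-true (larger? p j) (k , a , b , ℕP.≰⇒> (λ le → c (S⇒moved k (⇒initial k a b le)))))
    (λ e → let (k , a , b , lt) = does-true (larger? p j) e in
      St.⇒improperParent-i k a b (larger⇒kept k a b lt))

-- Every tree arises from exactly one move

-- Describes the enlarged tree without constructing it. The description holds for the output of
-- `apply` and for a given tree relative to its contraction, and `result-determines` identifies the
-- two.
data Result {n} (p : Parents n) (p' : Parents (suc n)) : Move n → Set where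
  leaf  : ∀ {v} → Leaf p p' v → Result p p' (leaf v)
  above : ∀ {k} (E : Insertion p p' (suc k)) → Insertion.Dominant E →
          (∀ v → v ≢ suc k → par p' (inject₁ v) ≢ fromℕ (suc n)) → Result p p' (above k)
  split : ∀ {j} (E : Insertion p p' (par p j)) → Insertion.Dominant E →
          (∀ v → v ≢ par p j → par p' (inject₁ v) ≡ fromℕ (suc n) → initial p j v ≡ true) →
          (∀ v → initial p j v ≡ true → par p' (inject₁ v) ≡ fromℕ (suc n)) → Result p p' (split j)

apply-result : ∀ {n} (p : Parents n) → IsTree p → ∀ m → Valid p m → Result p (lookup (apply p m)) m
apply-result p t (leaf v) _ = leaf (addLeaf-Leaf p v)
apply-result p t (above k) _ = above A.insertion A.dominant (λ v ne e → false≢true (A.moved⇒S v ne e))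
  where
  module A = Above p k
apply-result p t (split j) imp = split S.insertion S.dominant S.moved⇒S S.S⇒moved
  where module S = Split p t j imp

result-tree : ∀ {n} {p : Parents n} {p' m} → Result p p' m → IsTree p → IsTree p'
result-tree (leaf L) = LeafProps.tree→ L
result-tree (above E _ _) = InsertionProps.tree→ E
result-tree (split E _ _ _) = InsertionProps.tree→ E

Insertion-determines : ∀ {n} {p : Parents n} {p' p'' i} → Insertion p p' i → Insertion p p'' i →
  (∀ v → v ≢ i → par p' (inject₁ v) ≡ fromℕ (suc n) → par p'' (inject₁ v) ≡ fromℕ (suc n)) →
  (∀ v → v ≢ i → par p'' (inject₁ v) ≡ fromℕ (suc n) → par p' (inject₁ v) ≡ fromℕ (suc n)) →
  ∀ x → par p' x ≡ par p'' x
Insertion-determines {p' = p'} {p''} {i} E E' f g x with view x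
... | ‵fromℕ = trans (Insertion.par-last E) (sym (Insertion.par-last E'))
... | ‵inject₁ v with Insertion.step E v | Insertion.step E' v
... | at-i _ q | at-i _ q' = trans q (sym q')
... | at-i e _ | moved ne _ _ = ⊥-elim (ne e)
... | at-i e _ | kept ne _ = ⊥-elim (ne e)
... | moved ne q _ | _ = trans q (sym (f v ne q))
... | kept ne _ | at-i e _ = ⊥-elim (ne e)
... | kept ne _ | moved _ q' _ = trans (g v ne q') (sym q')
... | kept _ q | kept _ q' = trans q (sym q')

result-determines : ∀ {n} {p : Parents n} {p' p'' m} → Result p p' m → Result p p'' m → ∀ x → par p' x ≡ par p'' x
result-determines (leaf L) (leaf L') x with view x
... | ‵fromℕ = trans (Leaf.par-last L) (sym (Leaf.par-last L'))
... | ‵inject₁ v = trans (Leaf.par-old L v) (sym (Leaf.par-old L' v))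
result-determines (above E _ f) (above E' _ f') =
  Insertion-determines E E' (λ v ne e → ⊥-elim (f v ne e)) (λ v ne e → ⊥-elim (f' v ne e))
result-determines (split E _ f g) (split E' _ f' g') =
  Insertion-determines E E' (λ v ne e → g' v (f v ne e)) (λ v ne e → g v (f' v ne e))

Insertion-injective : ∀ {n} {p q : Parents n} {p' i} → Insertion p p' i → Insertion q p' i → ∀ v → par p v ≡ par q v
Insertion-injective {p = p} {q} {p'} {i} E E' v with Insertion.step E v | Insertion.step E' v
... | at-i refl _ | _ = inject₁-injective (trans (sym (Insertion.par-last E)) (Insertion.par-last E'))
... | moved _ _ _ | at-i refl _ = inject₁-injective (trans (sym (Insertion.par-last E)) (Insertion.par-last E'))
... | moved _ _ e | moved _ _ e' = trans e (sym e')
... | moved _ e _ | kept _ e' = ⊥-elim (fromℕ≢inject₁ (trans (sym e) e'))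
... | kept _ _ | at-i refl _ = inject₁-injective (trans (sym (Insertion.par-last E)) (Insertion.par-last E'))
... | kept _ e | moved _ e' _ = ⊥-elim (fromℕ≢inject₁ (trans (sym e') e))
... | kept _ e | kept _ e' = inject₁-injective (trans (sym e) e')

-- Reads `i` off `p'` alone, although the two smaller trees are not yet known to agree.
Dominant-unique : ∀ {n} {p q : Parents n} {p' i j} (E : Insertion p p' i) (E' : Insertion q p' j) →
  Insertion.Dominant E → Insertion.Dominant E' → i ≡ j
Dominant-unique {i = i} {j} E E' d d' with i FinP.≟ j
... | yes e = e
... | no ne = ⊥-elim (ℕP.<-asym (d j (λ e → ne (sym e)) (InsertionProps.par-i E')) (d' i ne (InsertionProps.par-i E)))

Leaf-childless : ∀ {n} {p : Parents n} {p' v} → Leaf p p' v → ∀ w → par p' (inject₁ w) ≢ fromℕ (suc n)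
Leaf-childless L w e = fromℕ≢inject₁ (trans (sym e) (Leaf.par-old L w))

-- `N` has no child after `leaf`, one after `above` and at least two after `split`, so moves of
-- different kinds cannot collide. For insertions, `Dominant-unique` fixes `i`, and undoing the
-- insertion at `i` fixes the smaller tree.
result-injective : ∀ {n} {p q : Parents n} {p' m m'} → IsTree p → IsTree q → Valid p m → Valid q m' →
  Result p p' m → Result q p' m' → (∀ v → par p v ≡ par q v) × m ≡ m'
result-injective t t' _ _ (leaf L) (leaf L') =
  (λ v → inject₁-injective (trans (sym (Leaf.par-old L v)) (Leaf.par-old L' v))) ,
  cong leaf (inject₁-injective (trans (sym (Leaf.par-last L)) (Leaf.par-last L')))
result-injective t t' _ _ (leaf L) (above {k} E _ _) = ⊥-elim (Leaf-childless L (suc k) (InsertionProps.par-i E))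
result-injective {q = q} t t' _ _ (leaf L) (split {j} E _ _ _) = ⊥-elim (Leaf-childless L (par q j) (InsertionProps.par-i E))
result-injective t t' _ _ (above {k} E _ _) (leaf L) = ⊥-elim (Leaf-childless L (suc k) (InsertionProps.par-i E))
result-injective {p = p} t t' _ _ (split {j} E _ _ _) (leaf L) = ⊥-elim (Leaf-childless L (par p j) (InsertionProps.par-i E))
result-injective t t' _ _ (above E d _) (above E' d' _) with Dominant-unique E E' d d'
... | refl = Insertion-injective E E' , refl
result-injective {q = q} t t' _ imp (above {k} E d f) (split {j} E' d' _ g') with Dominant-unique E E' d d'
... | e = ⊥-elim (f j (λ e' → S.j≢par-j (trans e' e)) (g' j (S.⇒initial j imp refl ℕP.≤-refl)))
  where module S = Split q t' j imp
result-injective {p = p} t t' imp _ (split {j} E d _ g) (above {k} E' d' f') with Dominant-unique E E' d d'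
... | e = ⊥-elim (f' j (λ e' → S.j≢par-j (trans e' (sym e))) (g j (S.⇒initial j imp refl ℕP.≤-refl)))
  where module S = Split p t j imp
result-injective {n} {p} {q} {p'} t t' imp imp' (split {j} E d f g) (split {j'} E' d' f' g') =
  same , cong split (β-sibling-injective p t (improper⇒≢0 p j imp) (improper⇒≢0 q j' imp')
    (trans i≡i' (sym (same j')))
    -- Each of `j` and `j'` is moved, hence lies in the segment bounded by the other; so their `β`
    -- agree.
    (ℕP.≤-antisym
      (subst₂ _≤_ (sym (X.β≗ j)) (sym (X.β≗ j')) (proj₂ (proj₂ (S'.initial⇒ j (f' j (λ e → S.j≢par-j (trans e (sym i≡i'))) (g j S-j))))))
      (proj₂ (proj₂ (S.initial⇒ j' (f j' (λ e → S'.j≢par-j (trans e i≡i')) (g' j' S'-j')))))))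
  where
  module S = Split p t j imp
  module S' = Split q t' j' imp'
  i≡i' : par p j ≡ par q j'
  i≡i' = Dominant-unique E E' d d'
  same : ∀ v → par p v ≡ par q v
  same = Insertion-injective E (subst (Insertion q p') (sym i≡i') E')
  module X = Ext p q (λ k → same (suc k))
  S-j : initial p j j ≡ true
  S-j = S.⇒initial j imp refl ℕP.≤-refl
  S'-j' : initial q j' j' ≡ true
  S'-j' = S'.⇒initial j' imp' refl ℕP.≤-refl

-- junk value at the last element
lower : ∀ {n} → V (suc n) → V n
lower x with view x
... | ‵fromℕ = zero
... | ‵inject₁ v = v

inject₁-lower : ∀ {n} (x : V (suc n)) → x ≢ fromℕ (suc n) → inject₁ (lower x) ≡ x
inject₁-lower x ne with view x
... | ‵fromℕ = ⊥-elim (ne refl)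
... | ‵inject₁ v = refl

lower-zero : ∀ {n} → lower {n} zero ≡ zero
lower-zero {n} = inject₁-injective (inject₁-lower zero (λ ()))

-- Removing the largest label

module Contract {n} (p' : Parents (suc n)) (t' : IsTree p') where

  N : V (suc n)
  N = fromℕ (suc n)

  par-N≢N : par p' N ≢ N
  par-N≢N e with () ← acyclic p' t' {N} (subst (λ y → Anc (par p') y N) (sym e) here)

  Preimage : Set
  Preimage = ∃ λ (c : Code n) → ∃ λ m → IsTree (lookup c) × Valid (lookup c) m × Result (lookup c) p' m

  childless : (∀ v → par p' (inject₁ v) ≢ N) → Preimage
  childless none = encode g , leaf (lower (par p' N)) , LeafProps.tree← isLeaf t' , tt , leaf isLeaf
    where
    g : V n → V n
    g v = lower (par p' (inject₁ v))
    isLeaf : Leaf (lookup (encode g)) p' (lower (par p' N))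
    isLeaf = record
      { par-last = sym (inject₁-lower _ par-N≢N)
      ; par-old = λ w → sym (trans (cong inject₁ (par-encode g lower-zero w)) (inject₁-lower _ (none w))) }

  module Absorb (i : V n) (par-i : par p' (inject₁ i) ≡ N)
    (max : ∀ v → par p' (inject₁ v) ≡ N → β p' (inject₁ v) ≤ β p' (inject₁ i)) where

    child≢0 : ∀ {v} → par p' (inject₁ v) ≡ N → inject₁ v ≢ zero
    child≢0 e e' = FinP.0≢1+n (trans (cong (par p') (sym e')) e)

    g : V n → V n
    g v = if does (par p' (inject₁ v) FinP.≟ N) then (if does (v FinP.≟ i) then lower (par p' N) else i) else lower (par p' (inject₁ v))

    c : Code n
    c = encode g

    p : Parents n
    p = lookup c

    par-p : ∀ v → par p v ≡ g v
    par-p = par-encode g lower-zero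

    g-i : g i ≡ lower (par p' N)
    g-i rewrite dec-true (par p' (inject₁ i) FinP.≟ N) par-i | dec-true (i FinP.≟ i) refl = refl

    g-child : ∀ v → v ≢ i → par p' (inject₁ v) ≡ N → g v ≡ i
    g-child v ne e rewrite dec-true (par p' (inject₁ v) FinP.≟ N) e | dec-false (v FinP.≟ i) ne = refl

    g-other : ∀ v → par p' (inject₁ v) ≢ N → g v ≡ lower (par p' (inject₁ v))
    g-other v ne rewrite dec-false (par p' (inject₁ v) FinP.≟ N) ne = refl

    step : ∀ v → Step p p' i v
    step v with v FinP.≟ i
    ... | yes refl = at-i refl par-i
    ... | no ne with par p' (inject₁ v) FinP.≟ N
    ...   | yes e = moved ne e (trans (par-p v) (g-child v ne e))
    ...   | no ne' = kept ne (sym (trans (cong inject₁ (trans (par-p v) (g-other v ne'))) (inject₁-lower _ ne')))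

    E : Insertion p p' i
    E = record
      { i≢0 = λ e → child≢0 par-i (cong inject₁ e)
      ; par-last = sym (trans (cong inject₁ (trans (par-p i) g-i)) (inject₁-lower _ par-N≢N))
      ; step = step }

    -- `max` gives only a weak inequality; it becomes strict because distinct siblings have distinct
    -- `β`.
    dominant : Insertion.Dominant E
    dominant v ne e = ℕP.≤∧≢⇒< (max v e) (λ e' → ne (inject₁-injective
      (β-sibling-injective p' t' (child≢0 e) (child≢0 par-i) (trans e (sym par-i)) e')))

    t : IsTree p
    t = InsertionProps.tree← E t'

    open InsertionProps E using (β-old)
    open InsertionProps.Stats E t dominant using (β-moved)

    alone : (∀ v → v ≢ i → par p' (inject₁ v) ≢ N) → Preimage
    alone none = go i E dominant none
      where
      -- `i` is a module parameter here; it is generalised so that it can be matched as `suc k`, the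
      -- form that `above` needs.
      go : ∀ i (E : Insertion p p' i) → Insertion.Dominant E → (∀ v → v ≢ i → par p' (inject₁ v) ≢ N) → Preimage
      go zero E _ _ = ⊥-elim (Insertion.i≢0 E refl)
      go (suc k) E d f = c , above k , t , tt , above E d f

    par-moved : ∀ {v} → v ≢ i → par p' (inject₁ v) ≡ N → par p v ≡ i
    par-moved {v} ne e = trans (par-p v) (g-child v ne e)

    improper-moved : ∀ {v} → v ≢ i → par p' (inject₁ v) ≡ N → improperChild p v ≡ true
    improper-moved {v} ne e = <⇒improper p v (subst (λ y → β p v < lbl y) (sym (par-moved ne e)) (β-moved ne e))

    -- `j` is the runner-up in `β` among the children of `N`, so the children other than `i` make up
    -- exactly the segment `initial p j`.
    accompanied : ∀ j → j ≢ i → par p' (inject₁ j) ≡ N →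
      (∀ v → v ≢ i × par p' (inject₁ v) ≡ N → β p' (inject₁ v) ≤ β p' (inject₁ j)) → Preimage
    accompanied j ne e maxj = c , split j , t , imp , result (par-moved ne e)
      where
      imp = improper-moved ne e
      module S = Split p t j imp
      to : ∀ v → v ≢ i → par p' (inject₁ v) ≡ N → initial p j v ≡ true
      to v nv ev = S.⇒initial v (improper-moved nv ev) (trans (par-moved nv ev) (sym (par-moved ne e)))
        (subst₂ _≤_ (β-old v nv) (β-old j ne) (maxj v (nv , ev)))
      from : ∀ v → initial p j v ≡ true → par p' (inject₁ v) ≡ N
      from v ev = from-step (step v)
        where
        from-step : Step p p' i v → par p' (inject₁ v) ≡ N
        from-step (at-i _ q) = q
        from-step (moved _ q _) = q
        -- A vertex that stays a child of `i` has `β` at least that of `inject₁ i`, which exceeds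
        -- that of `j`; it cannot belong to the segment.
        from-step (kept nv q) = ⊥-elim (ℕP.<⇒≱ (dominant j ne e) (begin
          β p' (inject₁ i)  ≤⟨ β-anti p' {inject₁ v} (up (subst (λ y → Anc (par p') y (inject₁ i)) (sym child-of-i) here)) ⟩
          β p' (inject₁ v)  ≡⟨ β-old v nv ⟩
          β p v             ≤⟨ proj₂ (proj₂ (S.initial⇒ v ev)) ⟩
          β p j             ≡⟨ sym (β-old j ne) ⟩
          β p' (inject₁ j)  ∎))
          where
          open ℕP.≤-Reasoning
          child-of-i : par p' (inject₁ v) ≡ inject₁ i
          child-of-i = trans q (cong inject₁ (trans (proj₁ (proj₂ (S.initial⇒ v ev))) (par-moved ne e)))
      result : par p j ≡ i → Result p p' (split j)
      result e' = split (subst (Insertion p p') (sym e') E) (dom' e') (λ v nv → to v (λ e'' → nv (trans e'' (sym e')))) from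
        where
        dom' : ∀ {x} (e' : x ≡ i) → Insertion.Dominant (subst (Insertion p p') (sym e') E)
        dom' refl = dominant

  preimage : Preimage
  preimage with any? (λ v → par p' (inject₁ v) FinP.≟ N)
  ... | no none = childless (λ v e → none (v , e))
  ... | yes ex with argmax (λ v → par p' (inject₁ v) FinP.≟ N) (λ v → β p' (inject₁ v)) ex
  ... | i , par-i , max with any? (λ v → ¬? (v FinP.≟ i) ×-dec (par p' (inject₁ v) FinP.≟ N))
  ...   | no none = Absorb.alone i par-i max (λ v ne e → none (v , ne , e))
  ...   | yes ex' with argmax (λ v → ¬? (v FinP.≟ i) ×-dec (par p' (inject₁ v) FinP.≟ N)) (λ v → β p' (inject₁ v)) ex'
  ...     | j , (ne , e) , maxj = Absorb.accompanied i par-i max j ne e maxj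

apply-surjective : ∀ {n} (c' : Code (suc n)) → IsTree (lookup c') →
  ∃ λ (c : Code n) → ∃ λ m → IsTree (lookup c) × Valid (lookup c) m × apply (lookup c) m ≡ c'
apply-surjective c' t' with Contract.preimage (lookup c') t'
... | c , m , t , v , r = c , m , t , v , code-ext (result-determines (apply-result (lookup c) t m v) r)

apply-injective : ∀ {n} {c d : Code n} {m m'} → IsTree (lookup c) → IsTree (lookup d) → Valid (lookup c) m → Valid (lookup d) m' →
  apply (lookup c) m ≡ apply (lookup d) m' → c ≡ d × m ≡ m'
apply-injective {c = c} {d} {m} {m'} t t' v v' e =
  let (same , e') = result-injective t t' v v' (apply-result (lookup c) t m v)
                      (subst (λ x → Result (lookup d) (lookup x) m') (sym e) (apply-result (lookup d) t' m' v'))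
  in code-ext same , e'

-- The list of trees

Unique-map : ∀ (f : A → B) xs → (∀ {x y} → x ∈ xs → y ∈ xs → f x ≡ f y → x ≡ y) → Unique xs → Unique (map f xs)
Unique-map f [] inj u = []
Unique-map f (x ∷ xs) inj (x∉ ∷ u) =
  AllP.map⁺ (All.tabulate (λ {y} y∈ e → All.lookup x∉ y∈ (inj (here refl) (there y∈) e))) ∷
  Unique-map f xs (λ a b → inj (there a) (there b)) u

Unique-concatMap : ∀ (f : A → List B) xs → Unique xs → (∀ {x} → x ∈ xs → Unique (f x)) →
  (∀ {x y z} → x ∈ xs → y ∈ xs → z ∈ f x → z ∈ f y → x ≡ y) → Unique (concatMap f xs)
Unique-concatMap f [] u h inj = []
Unique-concatMap f (x ∷ xs) (x∉ ∷ u) h inj = UniqueP.++⁺ (h (here refl))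
  (Unique-concatMap f xs u (λ i → h (there i)) (λ a b → inj (there a) (there b)))
  λ { (z∈ , z∈') → let (y , y∈ , z∈y) = find (∈-concatMap⁻ f z∈')
                   in All.lookup x∉ y∈ (inj (here refl) (there y∈) z∈ z∈y) }

-- Enumerates in the order of `allFuns`, so that the two lists correspond position by position.
allCodes : ∀ k m → List (Vec (Fin m) k)
allCodes zero m = [] ∷ []
allCodes (suc k) m = concatMap (λ c → map (_∷ c) (allFin m)) (allCodes k m)

∈-allCodes : ∀ {k m} (c : Vec (Fin m) k) → c ∈ allCodes k m
∈-allCodes [] = here refl
∈-allCodes {suc k} {m} (x ∷ c) = ∈-concatMap⁺ (λ c → map (_∷ c) (allFin m)) (lose (∈-allCodes c) (∈-map⁺ (_∷ c) (∈-allFin x)))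

allCodes-unique : ∀ k m → Unique (allCodes k m)
allCodes-unique zero m = [] ∷ []
allCodes-unique (suc k) m = Unique-concatMap (λ c → map (_∷ c) (allFin m)) (allCodes k m) (allCodes-unique k m)
  (λ {c} _ → UniqueP.map⁺ VecP.∷-injectiveˡ (UniqueP.allFin⁺ m)) same-tail
  where
  same-tail : ∀ {x y z} → x ∈ allCodes k m → y ∈ allCodes k m → z ∈ map (_∷ x) (allFin m) → z ∈ map (_∷ y) (allFin m) → x ≡ y
  same-tail {x} {y} _ _ a b with ∈-map⁻ (_∷ x) a | ∈-map⁻ (_∷ y) b
  ... | _ , _ , e | _ , _ , e' = VecP.∷-injectiveʳ (trans (sym e) e')

treeCodes : ∀ n → List (Code n)
treeCodes n = filter (λ c → isTree? (lookup c)) (allCodes n (suc n))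

treeCodes-unique : ∀ n → Unique (treeCodes n)
treeCodes-unique n = UniqueP.filter⁺ (λ c → isTree? (lookup c)) (allCodes-unique n (suc n))

∈-treeCodes⁺ : ∀ {n} {c : Code n} → IsTree (lookup c) → c ∈ treeCodes n
∈-treeCodes⁺ {n} {c} t = ∈-filter⁺ (λ c → isTree? (lookup c)) (∈-allCodes c) t

∈-treeCodes⁻ : ∀ {n} {c : Code n} → c ∈ treeCodes n → IsTree (lookup c)
∈-treeCodes⁻ {n} i = proj₂ (∈-filter⁻ (λ c → isTree? (lookup c)) {xs = allCodes n (suc n)} i)

Encodes : ∀ {k m} → (Fin k → Fin m) → Vec (Fin m) k → Set
Encodes f c = ∀ i → f i ≡ lookup c i

allFuns-allCodes : ∀ k m → Pointwise Encodes (allFuns k m) (allCodes k m)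
allFuns-allCodes zero m = (λ ()) ∷ []
allFuns-allCodes (suc k) m = Pointwise.concat⁺ (Pointwise.map⁺ _ _ (Pointwise.map cons⁺ (allFuns-allCodes k m)))
  where
  -- The underscore is the list built with the `cons` local to `allFuns`, which has no name in this
  -- scope.
  cons⁺ : ∀ {f c} → Encodes f c → Pointwise Encodes _ (map (_∷ c) (allFin m))
  cons⁺ h = Pointwise.map⁺ _ _ (Pointwise.refl (λ { zero → refl ; (suc i) → h i }))

trees-treeCodes : ∀ n → Pointwise Encodes (trees n) (treeCodes n)
trees-treeCodes n = Pointwise.filter⁺ isTree? (λ c → isTree? (lookup c))
  (λ {f} {c} h → Ext.IsTree→ f (lookup c) h) (λ {f} {c} h → Ext.IsTree→ (lookup c) f (λ i → sym (h i)))
  (allFuns-allCodes n (suc n))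

moves : ∀ {n} → Parents n → List (Move n)
moves {n} p = map leaf (allFin (suc n)) ++ map above (allFin n) ++
  map split (filter (λ j → improperChild p j Bool.≟ true) (allFin (suc n)))

∈-moves⁺ : ∀ {n} (p : Parents n) m → Valid p m → m ∈ moves p
∈-moves⁺ {n} p (leaf v) _ = ∈-++⁺ˡ (∈-map⁺ leaf (∈-allFin v))
∈-moves⁺ {n} p (above k) _ = ∈-++⁺ʳ (map leaf (allFin (suc n))) (∈-++⁺ˡ (∈-map⁺ above (∈-allFin k)))
∈-moves⁺ {n} p (split j) imp = ∈-++⁺ʳ (map leaf (allFin (suc n))) (∈-++⁺ʳ (map above (allFin n))
  (∈-map⁺ split (∈-filter⁺ (λ j → improperChild p j Bool.≟ true) (∈-allFin j) imp)))

∈-moves⁻ : ∀ {n} (p : Parents n) m → m ∈ moves p → Valid p m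
∈-moves⁻ {n} p (leaf v) _ = tt
∈-moves⁻ {n} p (above k) _ = tt
∈-moves⁻ {n} p (split j) i with ∈-++⁻ (map leaf (allFin (suc n))) i
... | inj₁ a with ∈-map⁻ leaf a
... | _ , _ , ()
∈-moves⁻ {n} p (split j) i | inj₂ a with ∈-++⁻ (map above (allFin n)) a
... | inj₁ b with ∈-map⁻ above b
... | _ , _ , ()
∈-moves⁻ {n} p (split j) i | inj₂ a | inj₂ b with ∈-map⁻ split b
... | j' , c , refl = proj₂ (∈-filter⁻ (λ j → improperChild p j Bool.≟ true) {xs = allFin (suc n)} c)

moves-unique : ∀ {n} (p : Parents n) → Unique (moves p)
moves-unique {n} p = UniqueP.++⁺ (UniqueP.map⁺ (λ { refl → refl }) (UniqueP.allFin⁺ (suc n)))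
  (UniqueP.++⁺ (UniqueP.map⁺ (λ { refl → refl }) (UniqueP.allFin⁺ n))
    (UniqueP.map⁺ (λ { refl → refl }) (UniqueP.filter⁺ (λ j → improperChild p j Bool.≟ true) (UniqueP.allFin⁺ (suc n))))
    above-split) leaf-rest
  where
  splits = map split (filter (λ j → improperChild p j Bool.≟ true) (allFin (suc n)))
  above-split : ∀ {m : Move n} → ¬ (m ∈ map above (allFin n) × m ∈ splits)
  above-split (a , b) with ∈-map⁻ above a | ∈-map⁻ split b
  ... | _ , _ , refl | _ , _ , ()
  leaf-rest : ∀ {m : Move n} → ¬ (m ∈ map leaf (allFin (suc n)) × m ∈ map above (allFin n) ++ splits)
  leaf-rest (a , b) with ∈-map⁻ leaf a | ∈-++⁻ (map above (allFin n)) b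
  ... | _ , _ , refl | inj₁ c with ∈-map⁻ above c
  ...   | _ , _ , ()
  leaf-rest (a , b) | _ , _ , refl | inj₂ c with ∈-map⁻ split c
  ...   | _ , _ , ()

grow : ∀ {n} → Code n → List (Code (suc n))
grow c = map (apply (lookup c)) (moves (lookup c))

-- Duplicate-free lists with the same members are permutations of each other. Injectivity of `apply`
-- gives the absence of duplicates, surjectivity one of the inclusions.
grow-treeCodes : ∀ n → concatMap grow (treeCodes n) ↭ treeCodes (suc n)
grow-treeCodes n = ∼bag⇒↭ (unique∧set⇒bag grow-unique (treeCodes-unique (suc n)) (mk⇔ to from))
  where
  valid : ∀ {c : Code n} {m} → m ∈ moves (lookup c) → Valid (lookup c) m
  valid {c} {m} = ∈-moves⁻ (lookup c) m
  same-code : ∀ {c d : Code n} {z} → c ∈ treeCodes n → d ∈ treeCodes n → z ∈ grow c → z ∈ grow d → c ≡ d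
  same-code {c} {d} c∈ d∈ a b with ∈-map⁻ (apply (lookup c)) a | ∈-map⁻ (apply (lookup d)) b
  ... | m , m∈ , e | m' , m'∈ , e' =
    proj₁ (apply-injective {c = c} {d} {m} {m'} (∈-treeCodes⁻ c∈) (∈-treeCodes⁻ d∈) (valid {c} m∈) (valid {d} m'∈) (trans (sym e) e'))
  grow-unique : Unique (concatMap grow (treeCodes n))
  grow-unique = Unique-concatMap grow (treeCodes n) (treeCodes-unique n)
    (λ {c} c∈ → Unique-map (apply (lookup c)) (moves (lookup c))
      (λ {m} {m'} m∈ m'∈ e → proj₂ (apply-injective {c = c} {c} {m} {m'} (∈-treeCodes⁻ c∈) (∈-treeCodes⁻ c∈) (valid {c} m∈) (valid {c} m'∈) e))
      (moves-unique (lookup c)))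
    same-code
  to : ∀ {c'} → c' ∈ concatMap grow (treeCodes n) → c' ∈ treeCodes (suc n)
  to i with find (∈-concatMap⁻ grow {xs = treeCodes n} i)
  ... | c , c∈ , j with ∈-map⁻ (apply (lookup c)) j
  ... | m , m∈ , refl = ∈-treeCodes⁺ (result-tree (apply-result (lookup c) t m (valid {c} m∈)) t)
    where t = ∈-treeCodes⁻ c∈
  from : ∀ {c'} → c' ∈ treeCodes (suc n) → c' ∈ concatMap grow (treeCodes n)
  from {c'} i with apply-surjective c' (∈-treeCodes⁻ i)
  ... | c , m , t , v , refl = ∈-concatMap⁺ grow (lose (∈-treeCodes⁺ {c = c} t) (∈-map⁺ (apply (lookup c)) (∈-moves⁺ (lookup c) m v)))

-- The effect of a move on the statistics

improperParent-above : ∀ {n} (p : Parents n) → IsTree p → ∀ k →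
  isImproperParent (lookup (apply p (above k))) (inject₁ (suc k)) ≡ isImproperParent p (suc k)
improperParent-above p t k = bool-ext
  (λ e → let (j , a , b , _) = St.improperParent-i⇒ e in ⇒improperParent p j a b)
  (λ e → let (j , a , b) = improperParent⇒ p (suc k) e in
    St.⇒improperParent-i j a b (λ q → false≢true (A.moved⇒S j (λ e' → St.par-i≢i (trans (cong (par p) (sym e')) b)) q)))
  where
  module A = Above p k
  module St = InsertionProps.Stats A.insertion t A.dominant

impe-above : ∀ {n} (p : Parents n) → IsTree p → ∀ k → impe (lookup (apply p (above k))) ≡ suc (impe p)
impe-above p t k = InsertionProps.Stats.impe-insert A.insertion t A.dominant
  where module A = Above p k

impp-above : ∀ {n} (p : Parents n) → IsTree p → ∀ k → impp (lookup (apply p (above k))) ≡ suc (impp p)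
impp-above p t k = ℕP.+-cancelʳ-≡ (ind (isImproperParent p (suc k))) (impp (lookup (apply p (above k)))) (suc (impp p))
  (trans (InsertionProps.Stats.impp-insert A.insertion t A.dominant)
    (cong (λ b → suc (impp p) ℕ.+ ind b) (improperParent-above p t k)))
  where module A = Above p k

impp-split : ∀ {n} (p : Parents n) → IsTree p → ∀ j → improperChild p j ≡ true →
  impp (lookup (apply p (split j))) ≡ impp p ℕ.+ ind (hasLarger p j)
impp-split p t j imp = ℕP.suc-injective (begin
  suc (impp p')                                      ≡⟨ ℕP.+-comm 1 (impp p') ⟩
  -- The `1` is the indicator that `par p j` was an improper parent before the move, as witnessed by
  -- `j`.
  impp p' ℕ.+ 1                                      ≡⟨ cong (λ b → impp p' ℕ.+ ind b) (sym (⇒improperParent p j imp refl)) ⟩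
  impp p' ℕ.+ ind (isImproperParent p (par p j))     ≡⟨ S.St.impp-insert ⟩
  suc (impp p) ℕ.+ ind (isImproperParent p' (inject₁ (par p j))) ≡⟨ cong (λ b → suc (impp p) ℕ.+ ind b) S.improperParent-split ⟩
  suc (impp p) ℕ.+ ind (hasLarger p j)               ∎)
  where
  open ≡-Reasoning
  module S = Split p t j imp
  p' = lookup (apply p (split j))

-- Hence the truncated exponents deg1 ∸ 1 and lead ∸ deg1 ∸ 1 are genuine differences.
deg1<lead : ∀ {n} (c : Code n) → IsTree (lookup c) → deg1 (lookup c) < lead (lookup c) × (1 ≤ n → 1 ≤ deg1 (lookup c))
-- In the one-vertex tree the root has no children and is leading, which gives 0 < 1.
deg1<lead {zero} [] t = s≤s z≤n , λ ()
deg1<lead {suc n} c' t' with apply-surjective c' t'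
... | c , leaf v , t , _ , refl =
  subst₂ _<_ (sym deg1-leaf) (sym (lead-leaf t)) (s≤s (ℕP.≤-trans
    (ℕP.+-monoʳ-≤ (deg1 (lookup c)) (ind≤1 (does (v FinP.≟ zero))))
    (ℕP.≤-trans (ℕP.≤-reflexive (ℕP.+-comm (deg1 (lookup c)) 1)) (proj₁ (deg1<lead c t))))) ,
  (λ _ → subst (1 ≤_) (sym deg1-leaf) (positive (deg1 (lookup c)) v (proj₂ (deg1<lead c t))))
  where
  open LeafProps (addLeaf-Leaf (lookup c) v)
  ind≤1 : ∀ b → ind b ≤ 1
  ind≤1 true = ℕP.≤-refl
  ind≤1 false = z≤n
  positive : ∀ {n} d (v : V n) → (1 ≤ n → 1 ≤ d) → 1 ≤ d ℕ.+ ind (does (v FinP.≟ zero))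
  -- A leaf added to the one-vertex tree can only go below the root, and this makes the degree
  -- positive.
  positive {zero} d zero _ = ℕP.m≤n+m 1 d
  positive {suc n} d v h = ℕP.≤-trans (h (s≤s z≤n)) (ℕP.m≤m+n _ _)
... | c , above k , t , _ , refl =
  subst₂ _<_ (sym St.deg1-insert) (sym St.lead-insert) (proj₁ (deg1<lead c t)) ,
  (λ _ → subst (1 ≤_) (sym St.deg1-insert) (proj₂ (deg1<lead c t) (ℕP.≤-<-trans z≤n (FinP.toℕ<n k))))
  where
  module A = Above (lookup c) k
  module St = InsertionProps.Stats A.insertion t A.dominant
... | c , split j , t , imp , refl =
  subst₂ _<_ (sym S.St.deg1-insert) (sym S.St.lead-insert) (proj₁ (deg1<lead c t)) ,
  (λ _ → subst (1 ≤_) (sym S.St.deg1-insert) (proj₂ (deg1<lead c t) (nonroot j (improper⇒≢0 (lookup c) j imp))))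
  where
  module S = Split (lookup c) t j imp
  nonroot : ∀ {n} (j : V n) → j ≢ zero → 1 ≤ n
  nonroot zero ne = ⊥-elim (ne refl)
  nonroot {suc n} (suc j) ne = s≤s z≤n

-- Summing over the moves

-- the weight before the substitution y ↦ y + 1, t ↦ t − 1
W : ∀ {n} → Parents n → Poly
W p = mon (impe p ℕ.∸ impp p) (impp p) (deg1 p ℕ.∸ 1) (lead p ℕ.∸ deg1 p ℕ.∸ 1)

-- The statistics are given as sums, so that every truncated difference in `W` cancels exactly.
W-cong : ∀ {n} (p : Parents n) h b d l → impe p ≡ h ℕ.+ b → impp p ≡ b → deg1 p ≡ suc d → lead p ≡ suc (suc d) ℕ.+ l →
  W p ≡ mon h b d l
W-cong p h b d l e₁ e₂ e₃ e₄ rewrite e₁ | e₂ | e₃ | e₄ | ℕP.m+n∸n≡m h b | ℕP.+-∸-assoc 1 (ℕP.m≤m+n d l) | ℕP.m+n∸m≡n d l = refl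

sumOver-if : ∀ (f g : A → Bool) p q xs →
  sumOver (λ x → if g x then p else q) (filter (λ x → f x Bool.≟ true) xs) ≃
  cst (+ length (filter (λ x → (f x ∧ g x) Bool.≟ true) xs)) *P p +P
  cst (+ length (filter (λ x → (f x ∧ not (g x)) Bool.≟ true) xs)) *P q
sumOver-if f g p q [] = P.sym (P.+-cong (P.trans (cst-zero *ʳ p) (P.zeroˡ p)) (P.trans (cst-zero *ʳ q) (P.zeroˡ q)))
sumOver-if f g p q (x ∷ xs) with f x | sumOver-if f g p q xs
... | false | ih = ih
... | true | ih with g x
...   | true = P.trans (p +ˡ ih) (P.trans
          (solve 4 (λ p q a b → p :+ (a :* p :+ b :* q) := (con 1 :+ a) :* p :+ b :* q) P.refl p q (cst (+ a)) (cst (+ b)))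
          ((P.sym (cst-suc a) *ʳ p) +ʳ cst (+ b) *P q))
  where
  a = length (filter (λ x → (f x ∧ g x) Bool.≟ true) xs)
  b = length (filter (λ x → (f x ∧ not (g x)) Bool.≟ true) xs)
...   | false = P.trans (q +ˡ ih) (P.trans
          (solve 4 (λ p q a b → q :+ (a :* p :+ b :* q) := a :* p :+ (con 1 :+ b) :* q) P.refl p q (cst (+ a)) (cst (+ b)))
          (cst (+ a) *P p +ˡ (P.sym (cst-suc b) *ʳ q)))
  where
  a = length (filter (λ x → (f x ∧ g x) Bool.≟ true) xs)
  b = length (filter (λ x → (f x ∧ not (g x)) Bool.≟ true) xs)

module Recurrence {n} (c : Code n) (t : IsTree (lookup c)) (1≤n : 1 ≤ n) where

  p : Parents n
  p = lookup c

  -- The four exponents of `W p`. The first is a count of improper children that are not largest,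
  -- which equals impe - impp by `impe≡`.
  h b d l : ℕ
  h = cnt (λ j → improperChild p j ∧ hasLarger p j)
  b = impp p
  d = deg1 p ℕ.∸ 1
  l = lead p ℕ.∸ suc (deg1 p)

  impe≡ : impe p ≡ h ℕ.+ b
  impe≡ = begin
    impe p                                ≡⟨ impe-cnt p ⟩
    cnt (improperChild p)                 ≡⟨ sum-cong-≗ (λ j → ind-split (improperChild p j) (hasLarger p j)) ⟩
    sum (λ j → ind (improperChild p j ∧ hasLarger p j) ℕ.+ ind (isLargest p j))
                                          ≡⟨ ∑-distrib-+ (λ j → ind (improperChild p j ∧ hasLarger p j)) (λ j → ind (isLargest p j)) ⟩
    h ℕ.+ cnt (isLargest p)               ≡⟨ cong (h ℕ.+_) (cnt-isLargest p t) ⟩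
    h ℕ.+ b                               ∎
    where
    open ≡-Reasoning
    ind-split : ∀ x y → ind x ≡ ind (x ∧ y) ℕ.+ ind (x ∧ not y)
    ind-split false y = refl
    ind-split true true = refl
    ind-split true false = refl

  deg1≡ : deg1 p ≡ suc d
  deg1≡ = sym (ℕP.m+[n∸m]≡n (proj₂ (deg1<lead c t) 1≤n))

  lead≡ : lead p ≡ suc (suc d) ℕ.+ l
  lead≡ = trans (sym (ℕP.m+[n∸m]≡n (proj₁ (deg1<lead c t)))) (cong (λ x → suc x ℕ.+ l) deg1≡)

  W-leaf-root : W (lookup (apply p (leaf zero))) ≡ mon h b (suc d) l
  W-leaf-root = W-cong (lookup (apply p (leaf zero))) h b (suc d) l (trans impe-leaf impe≡) impp-leaf
    (trans deg1-leaf (trans (ℕP.+-comm (deg1 p) 1) (cong suc deg1≡))) (trans (lead-leaf t) (cong suc lead≡))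
    where open LeafProps (addLeaf-Leaf p zero)

  W-leaf : ∀ k → W (lookup (apply p (leaf (suc k)))) ≡ mon h b d (suc l)
  W-leaf k = W-cong (lookup (apply p (leaf (suc k)))) h b d (suc l) (trans impe-leaf impe≡) impp-leaf
    (trans deg1-leaf (trans (ℕP.+-identityʳ _) deg1≡)) (trans (lead-leaf t) (trans (cong suc lead≡) (sym (ℕP.+-suc (suc (suc d)) l))))
    where open LeafProps (addLeaf-Leaf p (suc k))

  W-above : ∀ k → W (lookup (apply p (above k))) ≡ mon h (suc b) d l
  W-above k = W-cong (lookup (apply p (above k))) h (suc b) d l (trans (impe-above p t k) (trans (cong suc impe≡) (sym (ℕP.+-suc h b))))
    (impp-above p t k) (trans St.deg1-insert deg1≡) (trans St.lead-insert lead≡)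
    where
    module A = Above p k
    module St = InsertionProps.Stats A.insertion t A.dominant

  W-split : ∀ j → improperChild p j ≡ true →
    W (lookup (apply p (split j))) ≡ (if hasLarger p j then mon h (suc b) d l else mon (suc h) b d l)
  W-split j imp = by-cases (hasLarger p j) refl
    where
    module S = Split p t j imp
    impe' : impe (lookup (apply p (split j))) ≡ suc (h ℕ.+ b)
    impe' = trans S.St.impe-insert (cong suc impe≡)
    by-cases : ∀ x → hasLarger p j ≡ x → W (lookup (apply p (split j))) ≡ (if x then mon h (suc b) d l else mon (suc h) b d l)
    by-cases true e = W-cong (lookup (apply p (split j))) h (suc b) d l (trans impe' (sym (ℕP.+-suc h b)))
      (trans (impp-split p t j imp) (trans (cong (λ x → b ℕ.+ ind x) e) (ℕP.+-comm b 1)))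
      (trans S.St.deg1-insert deg1≡) (trans S.St.lead-insert lead≡)
    by-cases false e = W-cong (lookup (apply p (split j))) (suc h) b d l impe'
      (trans (impp-split p t j imp) (trans (cong (λ x → b ℕ.+ ind x) e) (ℕP.+-identityʳ b)))
      (trans S.St.deg1-insert deg1≡) (trans S.St.lead-insert lead≡)

  Wₘ : Move n → Poly
  Wₘ m = W (lookup (apply p m))

  leaves : sumOver Wₘ (map leaf (allFin (suc n))) ≃ mon h b (suc d) l +P cst (+ n) *P mon h b d (suc l)
  leaves = begin
    sumOver Wₘ (map leaf (allFin (suc n)))
      ≡⟨ sumOver-map Wₘ leaf (allFin (suc n)) ⟩
    Wₘ (leaf zero) +P sumOver (Wₘ ∘ leaf) rest
      ≈⟨ P.+-cong (P.reflexive W-leaf-root) (sumOver-cong rest at-suc) ⟩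
    mon h b (suc d) l +P sumOver (λ _ → mon h b d (suc l)) rest
      ≈⟨ mon h b (suc d) l +ˡ sumOver-const (mon h b d (suc l)) rest ⟩
    mon h b (suc d) l +P cst (+ length rest) *P mon h b d (suc l)
      ≡⟨ cong (λ k → mon h b (suc d) l +P cst (+ k) *P mon h b d (suc l)) (length-tabulate {n = n} Fin.suc) ⟩
    mon h b (suc d) l +P cst (+ n) *P mon h b d (suc l) ∎
    where
    open ≃R
    rest : List (V n)
    rest = tabulate Fin.suc
    at-suc : ∀ {v} → v ∈ rest → Wₘ (leaf v) ≃ mon h b d (suc l)
    at-suc i = let (k , e) = ∈-tabulate⁻ i in P.reflexive (trans (cong (λ v → Wₘ (leaf v)) e) (W-leaf k))

  aboves : sumOver Wₘ (map above (allFin n)) ≃ cst (+ n) *P mon h (suc b) d l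
  aboves = begin
    sumOver Wₘ (map above (allFin n))            ≡⟨ sumOver-map Wₘ above (allFin n) ⟩
    sumOver (Wₘ ∘ above) (allFin n)              ≈⟨ sumOver-cong (allFin n) (λ {k} _ → P.reflexive (W-above k)) ⟩
    sumOver (λ _ → mon h (suc b) d l) (allFin n) ≈⟨ sumOver-const (mon h (suc b) d l) (allFin n) ⟩
    cst (+ length (allFin n)) *P mon h (suc b) d l ≡⟨ cong (λ k → cst (+ k) *P mon h (suc b) d l) (length-tabulate {n = n} id) ⟩
    cst (+ n) *P mon h (suc b) d l               ∎
    where open ≃R

  splits : sumOver Wₘ (map split (filter (λ j → improperChild p j Bool.≟ true) (allFin (suc n)))) ≃
    cst (+ h) *P mon h (suc b) d l +P cst (+ b) *P mon (suc h) b d l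
  splits = begin
    sumOver Wₘ (map split js)
      ≡⟨ sumOver-map Wₘ split js ⟩
    sumOver (Wₘ ∘ split) js
      ≈⟨ sumOver-cong js (λ {j} i → P.reflexive (W-split j (proj₂ (∈-filter⁻ (λ j → improperChild p j Bool.≟ true) {xs = allFin (suc n)} i)))) ⟩
    sumOver (λ j → if hasLarger p j then mon h (suc b) d l else mon (suc h) b d l) js
      ≈⟨ sumOver-if (improperChild p) (hasLarger p) (mon h (suc b) d l) (mon (suc h) b d l) (allFin (suc n)) ⟩
    cst (+ length (filter (λ x → (improperChild p x ∧ hasLarger p x) Bool.≟ true) (allFin (suc n)))) *P mon h (suc b) d l +P
    cst (+ length (filter (λ x → isLargest p x Bool.≟ true) (allFin (suc n)))) *P mon (suc h) b d l
      ≡⟨ cong₂ (λ x y → cst (+ x) *P mon h (suc b) d l +P cst (+ y) *P mon (suc h) b d l)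
           (length-filter-tabulate (λ x → improperChild p x ∧ hasLarger p x) id)
           (trans (length-filter-tabulate (isLargest p) id) (cnt-isLargest p t)) ⟩
    cst (+ h) *P mon h (suc b) d l +P cst (+ b) *P mon (suc h) b d l ∎
    where
    open ≃R
    js = filter (λ j → improperChild p j Bool.≟ true) (allFin (suc n))

  recurrence : op n (W p) ≃ sumOver (W ∘ lookup) (grow c)
  recurrence = begin
    op n (W p)
      ≡⟨ cong (op n) (W-cong p h b d l impe≡ refl deg1≡ lead≡) ⟩
    op n (mon h b d l)
      ≈⟨ op-mon n h b d l ⟩
    x +P (cst (+ (n ℕ.+ h)) *P u +P z)
      -- The coefficient `n` + `h` is shared between the `n` moves `above` and the `h` moves `split`
      -- after which `i` remains an improper parent.
      ≈⟨ x +ˡ ((cst-+ n h *ʳ u) +ʳ z) ⟩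
    x +P ((cst (+ n) +P cst (+ h)) *P u +P z)
      ≈⟨ solve 5 (λ x n h u z → x :+ ((n :+ h) :* u :+ z) := x :+ (n :* u :+ (h :* u :+ z))) P.refl x (cst (+ n)) (cst (+ h)) u z ⟩
    x +P (cst (+ n) *P u +P (cst (+ h) *P u +P z))
      ≈⟨ P.sym (P.+-cong leaves (P.+-cong aboves splits)) ⟩
    sumOver Wₘ ls +P (sumOver Wₘ as +P sumOver Wₘ ss)
      ≈⟨ P.sym (P.trans (sumOver-++ Wₘ ls (as ++ ss)) (sumOver Wₘ ls +ˡ sumOver-++ Wₘ as ss)) ⟩
    sumOver Wₘ (moves p)
      ≡⟨ sym (sumOver-map (W ∘ lookup) (apply p) (moves p)) ⟩
    sumOver (W ∘ lookup) (grow c) ∎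
    where
    open ≃R
    x = mon h b (suc d) l +P cst (+ n) *P mon h b d (suc l)
    u = mon h (suc b) d l
    z = cst (+ b) *P mon (suc h) b d l
    ls = map leaf (allFin (suc n))
    as = map above (allFin n)
    ss = map split (filter (λ j → improperChild p j Bool.≟ true) (allFin (suc n)))

-- The generating function over all trees

Q-trees : ∀ k → Q (suc k) ≃ sumOver (W ∘ lookup) (treeCodes (suc k))
-- The only tree on two vertices is a single proper edge with both vertices leading: impe and impp
-- are 0, deg is 1, lead is 2, and the weight computes to 1.
Q-trees zero = pairing λ φ → refl
Q-trees (suc k) = begin
  op (suc k) (Q (suc k))
    ≈⟨ op-cong (suc k) (Q-trees k) ⟩
  op (suc k) (sumOver (W ∘ lookup) (treeCodes (suc k)))
    ≈⟨ sumOver-op (suc k) (W ∘ lookup) (treeCodes (suc k)) ⟩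
  sumOver (op (suc k) ∘ W ∘ lookup) (treeCodes (suc k))
    ≈⟨ sumOver-cong (treeCodes (suc k)) (λ {c} i → Recurrence.recurrence c (∈-treeCodes⁻ i) (s≤s z≤n)) ⟩
  sumOver (λ c → sumOver (W ∘ lookup) (grow c)) (treeCodes (suc k))
    ≈⟨ P.sym (sumOver-concatMap (W ∘ lookup) grow (treeCodes (suc k))) ⟩
  sumOver (W ∘ lookup) (concatMap grow (treeCodes (suc k)))
    ≈⟨ sumOver-↭ (W ∘ lookup) (grow-treeCodes (suc k)) ⟩
  sumOver (W ∘ lookup) (treeCodes (suc (suc k))) ∎
  where open ≃R

weight-trees : ∀ n → sumOver (weight ∘ lookup) (treeCodes n) ≡ RHS n
weight-trees n = go (trees-treeCodes n)
  where
  weight-ext : ∀ {p q : Parents n} → (∀ k → p k ≡ q k) → weight q ≡ weight p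
  weight-ext {p} {q} e = sym (w-cong (Ext.impe≗ p q e) (Ext.impp≗ p q e) (Ext.deg1≗ p q e) (Ext.lead≗ p q e))
    where
    w : ℕ → ℕ → ℕ → ℕ → Poly
    w a b d l = powP (Y +P cst (+ 1)) (a ℕ.∸ b) *P powP U b *P powP X (d ℕ.∸ 1) *P powP Z (l ℕ.∸ d ℕ.∸ 1)
    w-cong : ∀ {a a' b b' d d' l l'} → a ≡ a' → b ≡ b' → d ≡ d' → l ≡ l' → w a b d l ≡ w a' b' d' l'
    w-cong refl refl refl refl = refl
  go : ∀ {fs cs} → Pointwise Encodes fs cs → sumOver (weight ∘ lookup) cs ≡ sumP (map weight fs)
  go [] = refl
  go (e ∷ es) = cong₂ _+P_ (weight-ext e) (go es)

theorem13 : (n : ℕ) → 1 ≤ n → R n ≈P RHS n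
theorem13 (suc k) _ = ≃⇒≈P (begin
  shift (Q (suc k))
    ≈⟨ shift-cong (Q-trees k) ⟩
  shift (sumOver (W ∘ lookup) (treeCodes (suc k)))
    ≈⟨ sumOver-shift (W ∘ lookup) (treeCodes (suc k)) ⟩
  sumOver (shift ∘ W ∘ lookup) (treeCodes (suc k))
    ≈⟨ sumOver-cong (treeCodes (suc k)) (λ {c} _ → let p = lookup c in
         shift-mon (impe p ℕ.∸ impp p) (impp p) (deg1 p ℕ.∸ 1) (lead p ℕ.∸ deg1 p ℕ.∸ 1)) ⟩
  sumOver (weight ∘ lookup) (treeCodes (suc k))
    ≡⟨ weight-trees (suc k) ⟩
  RHS (suc k) ∎)
  where open ≃R
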